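{- Let $a,a',b,\ell,s,N,k,\Delta^-$ be positive integers with $k\ge 2$ and $2a'\ge a$, and let $T$ be a tournament on $N$ vertices with a median order $v_1,\dots,v_N$. Let $j$ be an integer with $2ka'<j\le N-a+1$ and let $B\subseteq[j,j+a)$ be an arbitrary subset of size at least $b$. Then there exist an integer $j'$ with $j-2ka'\le j'\le j-a'$ and a set $A\subseteq[j',j'+a')$ such that - $|A|\ge \frac{a'}{2}\left(\frac{k-1}{2k}\right)^{\ell}$, and - for all but at most $4\left(\frac{2k}{k-1}\right)^{\ell}\binom{a'}{\Delta^- }\left(\frac{s}{b}\right)^{\ell}$ subsets $S\subseteq A$ with $|S|=\Delta^-$, we have $|N^+(S)\cap B|\ge s+1$.
   Context: A tournament on $N$ vertices is an orientation of the edges of the complete graph $K_N$. A median order of a tournament $T$ is an ordering $v_1,\dots,v_N$ of its vertices that maximizes the number of forward edges, i.e. edges directed from $v_i$ to $v_j$ with $i<j$. Given a median order, $[i,j)$ denotes the vertex set $\{v_i,\dots,v_{j-1}\}$. For a set $S$ of vertices, $N^+(S)$ denotes the common out-neighborhood of $S$ in $T$, i.e. the set of vertices that are out-neighbors of every vertex of $S$. -}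

module Defs where

open import Data.Bool.Base using (true; false)
open import Data.Fin.Base using (Fin; toℕ)
open import Data.Fin.Permutation using (Permutation′; _⟨$⟩ʳ_; _⟨$⟩ˡ_)
open import Data.Fin.Properties using (all?; _<?_)
open import Data.Fin.Subset using (Subset; ∣_∣)
open import Data.Fin.Subset.Properties using (_∈?_; _⊆?_)
open import Data.List.Base using (List; []; _∷_; _++_; map; filter; length; allFin; cartesianProduct)
open import Data.List.Membership.Propositional using () renaming (_∈_ to _∈ₗ_)
open import Data.List.Membership.Propositional.Properties using (∈-++⁺ˡ; ∈-++⁺ʳ; ∈-map⁺; ∈-map⁻)
open import Data.List.Relation.Unary.Any using (here)
open import Data.List.Relation.Unary.AllPairs using ([]; _∷_)
open import Data.List.Relation.Unary.All using ([])
open import Data.List.Relation.Unary.Unique.Propositional using (Unique)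
open import Data.List.Relation.Unary.Unique.Propositional.Properties using (++⁺; map⁺)
open import Data.Integer.Base using (+_)
open import Data.Nat.Base using (ℕ; zero; suc; _∸_; _*_; _≤_; NonZero; NonTrivial; 2+)
import Data.Nat.Properties as ℕ
open import Data.Product.Base using (_×_; _,_)
open import Data.Rational.Base using (ℚ; _/_)
open import Data.Vec.Base using ([]; _∷_; tabulate)
open import Data.Vec.Properties using (∷-injectiveʳ)
open import Level using (0ℓ)
open import Relation.Binary.Core using (Rel)
open import Relation.Binary.Consequences using (tri⇒dec<)
open import Relation.Binary.Definitions using (Trichotomous) renaming (Decidable to Decidable₂)
open import Relation.Binary.PropositionalEquality using (_≡_; refl)
open import Relation.Nullary.Decidable using (does; ¬?; _×-dec_; _→-dec_)
open import Relation.Nullary.Negation using (¬_)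
open import Relation.Unary using (Pred; Decidable)

-- Trichotomy says that for any u and v exactly one of u ⟶ v, u ≡ v, v ⟶ u
-- holds: no loops, and exactly one direction for each edge of K_N.
record Tournament (N : ℕ) : Set₁ where
  field
    _⟶_     : Rel (Fin N) 0ℓ
    compare : Trichotomous _≡_ _⟶_

  _⟶?_ : Decidable₂ _⟶_
  _⟶?_ = tri⇒dec< compare

-- An ordering v₁,…,v_N of the vertices; v_{i+1} is  v ⟨$⟩ʳ i  for i : Fin N.
Ordering : ℕ → Set
Ordering N = Permutation′ N

forwardEdges : ∀ {N} → Tournament N → Ordering N → ℕ
forwardEdges {N} T v =
  length (filter (λ (i , j) → (i <? j) ×-dec ((v ⟨$⟩ʳ i) ⟶? (v ⟨$⟩ʳ j)))
                 (cartesianProduct (allFin N) (allFin N)))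
  where open Tournament T

IsMedianOrder : ∀ {N} → Tournament N → Ordering N → Set
IsMedianOrder T v = ∀ w → forwardEdges T w ≤ forwardEdges T v

comprehension : ∀ {n} {P : Pred (Fin n) 0ℓ} → Decidable P → Subset n
comprehension P? = tabulate (λ x → does (P? x))

-- The 1-based index of a vertex: x is v_{position v x}.
position : ∀ {N} → Ordering N → Fin N → ℕ
position v x = suc (toℕ (v ⟨$⟩ˡ x))

-- [ i , j ⟩ v  is the vertex set {v_i,…,v_{j-1}}.
[_,_⟩ : ∀ {N} → ℕ → ℕ → Ordering N → Subset N
[ i , j ⟩ v = comprehension (λ x → (i ℕ.≤? position v x) ×-dec (position v x ℕ.<? j))

-- Common out-neighbourhood: y such that x ⟶ y for every x ∈ S.
N⁺ : ∀ {N} → Tournament N → Subset N → Subset N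
N⁺ T S = comprehension (λ y → all? (λ x → (x ∈? S) →-dec (x ⟶? y)))
  where open Tournament T

allSubsets : ∀ n → List (Subset n)
allSubsets zero    = [] ∷ []
allSubsets (suc n) = map (true ∷_) (allSubsets n) ++ map (false ∷_) (allSubsets n)

allSubsets-complete : ∀ {n} (S : Subset n) → S ∈ₗ allSubsets n
allSubsets-complete []                  = here refl
allSubsets-complete (true ∷ S)          = ∈-++⁺ˡ (∈-map⁺ _ (allSubsets-complete S))
allSubsets-complete {suc n} (false ∷ S) =
  ∈-++⁺ʳ (map (true ∷_) (allSubsets n)) (∈-map⁺ _ (allSubsets-complete S))

allSubsets-unique : ∀ n → Unique (allSubsets n)
allSubsets-unique zero    = [] ∷ []
allSubsets-unique (suc n) =
  ++⁺ (map⁺ ∷-injectiveʳ (allSubsets-unique n))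
      (map⁺ ∷-injectiveʳ (allSubsets-unique n))
      disjoint
  where
  disjoint : ∀ {S} → ¬ (S ∈ₗ map (true ∷_) (allSubsets n) × S ∈ₗ map (false ∷_) (allSubsets n))
  disjoint (p , q) with ∈-map⁻ (true ∷_) p | ∈-map⁻ (false ∷_) q
  ... | _ , _ , refl | _ , _ , ()

-- The number of d-element subsets S of A for which P S fails.
exceptions : ∀ {n} {P : Pred (Subset n) 0ℓ} → Decidable P → Subset n → ℕ → ℕ
exceptions {n} P? A d =
  length (filter (λ S → (S ⊆? A) ×-dec ((∣ S ∣ ℕ.≟ d) ×-dec ¬? (P? S))) (allSubsets n))

-- NonTrivial k is the library's form of k ≥ 2.
[k-1]/[2k] : ∀ k → .{{NonTrivial k}} → ℚ
[k-1]/[2k] k = _/_ (+ (k ∸ 1)) (2 * k) {{2k-nonZero k}}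
  where
  2k-nonZero : ∀ k → .{{NonTrivial k}} → NonZero (2 * k)
  2k-nonZero (2+ _) = _

[2k]/[k-1] : ∀ k → .{{NonTrivial k}} → ℚ
[2k]/[k-1] k = _/_ (+ (2 * k)) (k ∸ 1) {{k-1-nonZero k}}
  where
  k-1-nonZero : ∀ k → .{{NonTrivial k}} → NonZero (k ∸ 1)
  k-1-nonZero (2+ _) = _

{-# OPTIONS --safe #-}

-- In a median order every vertex has, among the vertices of any interval ending
-- just before it, at least as many in-neighbours as out-neighbours, since moving
-- it to the start of the interval cannot gain forward edges.  As B lies within
-- 2a′ positions of v_j, each of its vertices thus has at least (k − 1)a′
-- in-neighbours among the 2ka′ vertices preceding v_j, so one of the 2k blocks of
-- length a′ there sends B a (k − 1)/(2k) proportion of all possible edges.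
-- Dependent random choice in that block finishes: let A be the common
-- in-neighbourhood in the block of a random ℓ-tuple from B.  Convexity bounds
-- the mean of |A| from below, a Δ-set with at most s common out-neighbours in B
-- survives with probability at most (s/|B|)^ℓ, and some tuple is good for both.
module Submission where

-- Indicator functions and finite sums over lists.

module FiniteSums where
  open import Data.Bool.Base using (if_then_else_)
  open import Data.Fin.Base using (Fin; zero; suc; toℕ; punchIn)
  open import Data.Fin.Permutation using (Permutation′; _⟨$⟩ʳ_)
  open import Data.List.Base
    using (List; []; _∷_; _++_; map; filter; length; allFin; tabulate; cartesianProductWith)
  open import Data.List.Properties using (map-cong; map-∘; map-++; map-tabulate)
  open import Data.Nat.Base using (ℕ; zero; suc; _+_; _*_; _≤_; z≤n; s≤s)
  open import Data.Nat.ListAction using (sum)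
  open import Data.Nat.ListAction.Properties using (sum-++)
  open import Data.Nat.Properties
    using (+-mono-≤; +-identityʳ; *-zeroʳ; *-distribˡ-+; *-distribʳ-+; ≤-refl
          ; +-0-commutativeMonoid; _<?_)
  open import Data.Nat.Tactic.RingSolver using (solve-∀)
  open import Data.Sum.Base using (_⊎_; inj₁; inj₂)
  open import Function.Base using (_∘_; id)
  open import Level using (Level)
  open import Relation.Binary.PropositionalEquality
  open import Relation.Nullary.Decidable using (Dec; yes; no; does; _×-dec_)
  open import Relation.Nullary.Negation using (¬_; contradiction)
  open import Relation.Unary using (Pred; Decidable)
  import Algebra.Properties.CommutativeMonoid.Sum +-0-commutativeMonoid as Fin∑

  private variable
    a b c p q r : Level
    A : Set a
    B : Set b
    C : Set c
    P : Set p
    Q : Set q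
    R : Set r

  𝟙 : Dec P → ℕ
  𝟙 P? = if does P? then 1 else 0

  𝟙-yes : (P? : Dec P) → P → 𝟙 P? ≡ 1
  𝟙-yes (yes _) _ = refl
  𝟙-yes (no ¬p) p = contradiction p ¬p

  𝟙-no : (P? : Dec P) → ¬ P → 𝟙 P? ≡ 0
  𝟙-no (yes p) ¬p = contradiction p ¬p
  𝟙-no (no _)  _  = refl

  𝟙≤1 : (P? : Dec P) → 𝟙 P? ≤ 1
  𝟙≤1 (yes _) = ≤-refl
  𝟙≤1 (no _)  = z≤n

  𝟙-mono : (P? : Dec P) (Q? : Dec Q) → (P → Q) → 𝟙 P? ≤ 𝟙 Q?
  𝟙-mono (no _)  _       _ = z≤n
  𝟙-mono (yes _) (yes _) _ = ≤-refl
  𝟙-mono (yes p) (no ¬q) f = contradiction (f p) ¬q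

  𝟙-cong : (P? : Dec P) (Q? : Dec Q) → (P → Q) → (Q → P) → 𝟙 P? ≡ 𝟙 Q?
  𝟙-cong (yes p) Q? f g = sym (𝟙-yes Q? (f p))
  𝟙-cong (no ¬p) Q? f g = sym (𝟙-no Q? (¬p ∘ g))

  𝟙-× : (P? : Dec P) (Q? : Dec Q) → 𝟙 (P? ×-dec Q?) ≡ 𝟙 P? * 𝟙 Q?
  𝟙-× (yes _) (yes _) = refl
  𝟙-× (yes _) (no _)  = refl
  𝟙-× (no _)  _       = refl

  𝟙-⊎ : (P? : Dec P) (Q? : Dec Q) (R? : Dec R) →
        (P → Q ⊎ R) → (Q → P) → (R → P) → (Q → ¬ R) → 𝟙 P? ≡ 𝟙 Q? + 𝟙 R?
  𝟙-⊎ P? (yes q) (yes r) _ _ _ k = contradiction r (k q)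
  𝟙-⊎ P? (yes q) (no _)  _ g _ _ = 𝟙-yes P? (g q)
  𝟙-⊎ P? (no _)  (yes r) _ _ h _ = 𝟙-yes P? (h r)
  𝟙-⊎ P? (no ¬q) (no ¬r) f _ _ _ = 𝟙-no P? λ p → case⊎ (f p)
    where
    case⊎ : ¬ (_ ⊎ _)
    case⊎ (inj₁ q) = ¬q q
    case⊎ (inj₂ r) = ¬r r

  ∑ : List A → (A → ℕ) → ℕ
  ∑ xs f = sum (map f xs)

  infixr 10 ∑
  syntax ∑ xs (λ x → e) = ∑[ x ∈ xs ] e

  ∑-cong : (xs : List A) {f g : A → ℕ} → (∀ x → f x ≡ g x) → ∑ xs f ≡ ∑ xs g
  ∑-cong xs f≗g = cong sum (map-cong f≗g xs)

  ∑-mono-≤ : (xs : List A) {f g : A → ℕ} → (∀ x → f x ≤ g x) → ∑ xs f ≤ ∑ xs g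
  ∑-mono-≤ []       f≤g = z≤n
  ∑-mono-≤ (x ∷ xs) f≤g = +-mono-≤ (f≤g x) (∑-mono-≤ xs f≤g)

  ∑-const : (xs : List A) (m : ℕ) → ∑[ _ ∈ xs ] m ≡ length xs * m
  ∑-const []       m = refl
  ∑-const (x ∷ xs) m = cong (m +_) (∑-const xs m)

  ∑-zero : (xs : List A) → ∑[ _ ∈ xs ] 0 ≡ 0
  ∑-zero xs = trans (∑-const xs 0) (*-zeroʳ (length xs))

  ∑-distrib-+ : (xs : List A) (f g : A → ℕ) → ∑[ x ∈ xs ] (f x + g x) ≡ ∑ xs f + ∑ xs g
  ∑-distrib-+ []       f g = refl
  ∑-distrib-+ (x ∷ xs) f g =
    trans (cong (f x + g x +_) (∑-distrib-+ xs f g)) (interchange (f x) (g x) (∑ xs f) (∑ xs g))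
    where
    interchange : ∀ u v w z → u + v + (w + z) ≡ u + w + (v + z)
    interchange = solve-∀

  *-distribˡ-∑ : (m : ℕ) (xs : List A) (f : A → ℕ) → m * ∑ xs f ≡ ∑[ x ∈ xs ] (m * f x)
  *-distribˡ-∑ m []       f = *-zeroʳ m
  *-distribˡ-∑ m (x ∷ xs) f =
    trans (*-distribˡ-+ m (f x) (∑ xs f)) (cong (m * f x +_) (*-distribˡ-∑ m xs f))

  *-distribʳ-∑ : (m : ℕ) (xs : List A) (f : A → ℕ) → ∑ xs f * m ≡ ∑[ x ∈ xs ] (f x * m)
  *-distribʳ-∑ m []       f = refl
  *-distribʳ-∑ m (x ∷ xs) f =
    trans (*-distribʳ-+ m (f x) (∑ xs f)) (cong (f x * m +_) (*-distribʳ-∑ m xs f))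

  ∑-comm : (xs : List A) (ys : List B) (f : A → B → ℕ) →
           ∑[ x ∈ xs ] ∑[ y ∈ ys ] f x y ≡ ∑[ y ∈ ys ] ∑[ x ∈ xs ] f x y
  ∑-comm []       ys f = sym (∑-zero ys)
  ∑-comm (x ∷ xs) ys f =
    trans (cong (∑ ys (f x) +_) (∑-comm xs ys f)) (sym (∑-distrib-+ ys (f x) _))

  ∑-map : (xs : List A) (h : A → B) (f : B → ℕ) → ∑ (map h xs) f ≡ ∑ xs (f ∘ h)
  ∑-map xs h f = cong sum (sym (map-∘ xs))

  ∑-++ : (xs ys : List A) (f : A → ℕ) → ∑ (xs ++ ys) f ≡ ∑ xs f + ∑ ys f
  ∑-++ xs ys f = trans (cong sum (map-++ f xs ys)) (sum-++ (map f xs) (map f ys))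

  ∑-cartesianProductWith : (h : A → B → C) (xs : List A) (ys : List B) (f : C → ℕ) →
    ∑ (cartesianProductWith h xs ys) f ≡ ∑[ x ∈ xs ] ∑[ y ∈ ys ] f (h x y)
  ∑-cartesianProductWith h []       ys f = refl
  ∑-cartesianProductWith h (x ∷ xs) ys f =
    trans (∑-++ (map (h x) ys) _ f)
          (cong₂ _+_ (∑-map ys (h x) f) (∑-cartesianProductWith h xs ys f))

  ∑-filter : {S : Pred A p} (S? : Decidable S) (xs : List A) (f : A → ℕ) →
             ∑ (filter S? xs) f ≡ ∑[ x ∈ xs ] (𝟙 (S? x) * f x)
  ∑-filter S? []       f = refl
  ∑-filter S? (x ∷ xs) f with S? x
  ... | yes _ = cong₂ _+_ (sym (+-identityʳ (f x))) (∑-filter S? xs f)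
  ... | no  _ = ∑-filter S? xs f

  length-filter-∑ : {S : Pred A p} (S? : Decidable S) (xs : List A) →
                    length (filter S? xs) ≡ ∑[ x ∈ xs ] 𝟙 (S? x)
  length-filter-∑ S? []       = refl
  length-filter-∑ S? (x ∷ xs) with S? x
  ... | yes _ = cong suc (length-filter-∑ S? xs)
  ... | no  _ = length-filter-∑ S? xs

  ∑-allFin : ∀ {n} (f : Fin n → ℕ) → ∑ (allFin n) f ≡ Fin∑.sum f
  ∑-allFin f = trans (cong sum (map-tabulate id f)) (sum-tabulate f)
    where
    sum-tabulate : ∀ {n} (f : Fin n → ℕ) → sum (tabulate f) ≡ Fin∑.sum f
    sum-tabulate {zero}  f = refl
    sum-tabulate {suc n} f = cong (f zero +_) (sum-tabulate (f ∘ suc))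

  ∑-permute : ∀ {n} (f : Fin n → ℕ) (π : Permutation′ n) →
              ∑ (allFin n) f ≡ ∑[ i ∈ allFin n ] f (π ⟨$⟩ʳ i)
  ∑-permute f π =
    trans (∑-allFin f) (trans (Fin∑.sum-permute f π) (sym (∑-allFin (f ∘ (π ⟨$⟩ʳ_)))))

  ∑-punchIn : ∀ {n} (i : Fin (suc n)) (f : Fin (suc n) → ℕ) →
              ∑ (allFin (suc n)) f ≡ f i + ∑[ j ∈ allFin n ] f (punchIn i j)
  ∑-punchIn i f =
    trans (∑-allFin f) (trans (Fin∑.sum-remove {i = i} f) (cong (f i +_) (sym (∑-allFin (f ∘ punchIn i)))))

  -- Serves to isolate one vertex in a sum over ordered pairs: the diagonal entry, its row, its
  -- column, and the pairs that avoid it.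
  ∑∑-punchIn : ∀ {n} (i : Fin (suc n)) (f : Fin (suc n) → Fin (suc n) → ℕ) →
    ∑[ x ∈ allFin (suc n) ] ∑[ y ∈ allFin (suc n) ] f x y ≡
    f i i + (∑[ y ∈ allFin n ] f i (punchIn i y)) +
      ((∑[ x ∈ allFin n ] f (punchIn i x) i) +
       (∑[ x ∈ allFin n ] ∑[ y ∈ allFin n ] f (punchIn i x) (punchIn i y)))
  ∑∑-punchIn {n} i f = trans (∑-punchIn i _)
    (cong₂ _+_ (∑-punchIn i (f i))
      (trans (∑-cong (allFin n) (λ x → ∑-punchIn i (f (punchIn i x))))
             (∑-distrib-+ (allFin n) _ _)))

  ∑-allFin-suc : ∀ {n} (f : Fin (suc n) → ℕ) →
                 ∑ (allFin (suc n)) f ≡ f zero + ∑[ i ∈ allFin n ] f (suc i)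
  ∑-allFin-suc f = ∑-punchIn zero f

  ∑-𝟙< : ∀ {n} m → m ≤ n → ∑[ i ∈ allFin n ] 𝟙 (toℕ i <? m) ≡ m
  ∑-𝟙< {n} zero    _ = trans (∑-cong (allFin n) λ i → 𝟙-no (toℕ i <? 0) λ ()) (∑-zero (allFin n))
  ∑-𝟙< {suc n} (suc m) (s≤s m≤n) =
    trans (∑-allFin-suc {n} (λ i → 𝟙 (toℕ i <? suc m)))
          (cong suc (trans
            (∑-cong (allFin n) λ i → 𝟙-cong (suc (toℕ i) <? suc m) (toℕ i <? m) (λ { (s≤s p) → p }) s≤s)
            (∑-𝟙< m m≤n)))

-- In-degrees of vertices in a median order.

module MedianOrders where
  open import Defs
  open import Data.Fin.Base as Fin using (Fin; zero; suc; toℕ; fromℕ<; punchIn)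
  open import Data.Fin.Permutation as Perm
    using (Permutation; _⟨$⟩ʳ_; _⟨$⟩ˡ_; _∘ₚ_; flip; insert; insert-punchIn
          ; inverseˡ; inverseʳ)
  open import Data.Fin.Properties
    using (_≟_; toℕ-fromℕ<; toℕ≤pred[n]; toℕ<n; punchIn-mono-≤; punchIn-cancel-≤; punchInᵢ≢i)
    renaming (_<?_ to _<ᶠ?_)
  open import Data.List.Base using (allFin; cartesianProduct)
  open import Data.Nat.Base using (ℕ; zero; suc; _+_; _*_; _≤_; _<_; z≤n; s≤s; z<s; s<s)
  open import Data.Nat.Properties hiding (_≟_)
  open import Data.Nat.Tactic.RingSolver using (solve-∀)
  open import Data.Product.Base using (_,_; proj₁)
  open import Data.Sum.Base using (inj₁; inj₂)
  open import Function.Base using (_∘_)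
  open import Relation.Binary.Definitions using (Tri; tri<; tri≈; tri>)
  open import Relation.Binary.PropositionalEquality
  open import Relation.Nullary.Decidable using (yes; no; _×-dec_)
  open import Relation.Nullary.Negation using (contradiction)
  open FiniteSums

  insert-self : ∀ {m n} i j (π : Permutation m n) → insert i j π ⟨$⟩ʳ i ≡ j
  insert-self i j π with i ≟ i
  ... | yes _  = refl
  ... | no i≢i = contradiction refl i≢i

  -- `punchIn i` shifts up by one from `i` on, hence the weak inequality here and the strict one in
  -- `punchIn<i⁺`.
  i<punchIn⁺ : ∀ {n} (i : Fin (suc n)) j → toℕ i ≤ toℕ j → i Fin.< punchIn i j
  i<punchIn⁺ zero    j       _         = z<s
  i<punchIn⁺ (suc i) (suc j) (s≤s i≤j) = s<s (i<punchIn⁺ i j i≤j)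

  i<punchIn⁻ : ∀ {n} (i : Fin (suc n)) j → i Fin.< punchIn i j → toℕ i ≤ toℕ j
  i<punchIn⁻ zero    j       _       = z≤n
  i<punchIn⁻ (suc i) (suc j) (s≤s p) = s≤s (i<punchIn⁻ i j p)

  toℕ-punchIn-< : ∀ {n} (i : Fin (suc n)) j → toℕ j < toℕ i → toℕ (punchIn i j) ≡ toℕ j
  toℕ-punchIn-< (suc i) zero    _         = refl
  toℕ-punchIn-< (suc i) (suc j) (s≤s j<i) = cong suc (toℕ-punchIn-< i j j<i)

  punchIn<i⁺ : ∀ {n} (i : Fin (suc n)) j → toℕ j < toℕ i → punchIn i j Fin.< i
  punchIn<i⁺ i j j<i = subst (_< toℕ i) (sym (toℕ-punchIn-< i j j<i)) j<i

  punchIn<i⁻ : ∀ {n} (i : Fin (suc n)) j → punchIn i j Fin.< i → toℕ j < toℕ i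
  punchIn<i⁻ i j p = ≰⇒> λ i≤j → <-asym p (i<punchIn⁺ i j i≤j)

  𝟙-punchIn-< : ∀ {n} (i : Fin (suc n)) j k → 𝟙 (punchIn i j <ᶠ? punchIn i k) ≡ 𝟙 (j <ᶠ? k)
  𝟙-punchIn-< i j k = 𝟙-cong (punchIn i j <ᶠ? punchIn i k) (j <ᶠ? k)
    (λ p → ≰⇒> (<⇒≱ p ∘ punchIn-mono-≤ i k j))
    (λ p → ≰⇒> (<⇒≱ p ∘ punchIn-cancel-≤ i k j))

  -- The indices below `m` split into those below `i` and those of the interval; the additive form
  -- avoids truncated subtraction.
  ∑-𝟙-interval : ∀ {n i m} → i ≤ m → m ≤ n →
    i + (∑[ x ∈ allFin n ] 𝟙 ((i ≤? toℕ x) ×-dec (toℕ x <? m))) ≡ m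
  ∑-𝟙-interval {n} {i} {m} i≤m m≤n = begin
    i + ∑ (allFin n) (λ x → 𝟙 ((i ≤? toℕ x) ×-dec (toℕ x <? m)))
      ≡⟨ cong (_+ ∑ (allFin n) (λ x → 𝟙 ((i ≤? toℕ x) ×-dec (toℕ x <? m)))) (∑-𝟙< i (≤-trans i≤m m≤n)) ⟨
    ∑ (allFin n) (λ x → 𝟙 (toℕ x <? i)) + ∑ (allFin n) (λ x → 𝟙 ((i ≤? toℕ x) ×-dec (toℕ x <? m)))
      ≡⟨ ∑-distrib-+ (allFin n) _ _ ⟨
    ∑ (allFin n) (λ x → 𝟙 (toℕ x <? i) + 𝟙 ((i ≤? toℕ x) ×-dec (toℕ x <? m)))
      ≡⟨ ∑-cong (allFin n) (λ x → sym (split x)) ⟩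
    ∑ (allFin n) (λ x → 𝟙 (toℕ x <? m))
      ≡⟨ ∑-𝟙< m m≤n ⟩
    m ∎
    where
    open ≡-Reasoning
    split : ∀ (x : Fin n) → 𝟙 (toℕ x <? m) ≡ 𝟙 (toℕ x <? i) + 𝟙 ((i ≤? toℕ x) ×-dec (toℕ x <? m))
    split x = 𝟙-⊎ (toℕ x <? m) (toℕ x <? i) ((i ≤? toℕ x) ×-dec (toℕ x <? m))
      (λ x<m → case (<-≤-connex (toℕ x) i) x<m)
      (λ x<i → <-≤-trans x<i i≤m)
      (λ { (_ , x<m) → x<m })
      (λ { x<i (i≤x , _) → <⇒≱ x<i i≤x })
      where
      case : _ → toℕ x < m → _
      case (inj₁ x<i) _   = inj₁ x<i
      case (inj₂ i≤x) x<m = inj₂ (i≤x , x<m)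

  module _ {N} (T : Tournament N) where
    open Tournament T

    edge : Fin N → Fin N → ℕ
    edge x y = 𝟙 (x ⟶? y)

    edge-sum : ∀ {x y} → x ≢ y → edge x y + edge y x ≡ 1
    edge-sum {x} {y} x≢y = go (compare x y)
      where
      go : Tri (x ⟶ y) (x ≡ y) (y ⟶ x) → edge x y + edge y x ≡ 1
      go (tri< x⟶y _ y↛x) = cong₂ _+_ (𝟙-yes (x ⟶? y) x⟶y) (𝟙-no (y ⟶? x) y↛x)
      go (tri≈ _ x≡y _)   = contradiction x≡y x≢y
      go (tri> x↛y _ y⟶x) = cong₂ _+_ (𝟙-no (x ⟶? y) x↛y) (𝟙-yes (y ⟶? x) y⟶x)

    forwardEdges-∑ : ∀ v → forwardEdges T v ≡
      ∑[ i ∈ allFin N ] ∑[ j ∈ allFin N ] (𝟙 (i <ᶠ? j) * edge (v ⟨$⟩ʳ i) (v ⟨$⟩ʳ j))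
    forwardEdges-∑ v =
      trans (length-filter-∑ (λ (i , j) → (i <ᶠ? j) ×-dec ((v ⟨$⟩ʳ i) ⟶? (v ⟨$⟩ʳ j)))
                             (cartesianProduct (allFin N) (allFin N)))
      (trans (∑-cartesianProductWith _,_ (allFin N) (allFin N) _)
      (∑-cong (allFin N) λ i → ∑-cong (allFin N) λ j →
        𝟙-× (i <ᶠ? j) ((v ⟨$⟩ʳ i) ⟶? (v ⟨$⟩ʳ j))))

    -- The order `flip π ∘ₚ v` has the vertex `v ⟨$⟩ʳ i` at index `π ⟨$⟩ʳ i`. Permuting both
    -- summation indices by `π` therefore keeps the edge terms of `v` and changes only the test of
    -- which vertex comes first.
    forwardEdges-flip-∘ : ∀ π v → forwardEdges T (flip π ∘ₚ v) ≡
      ∑[ i ∈ allFin N ] ∑[ j ∈ allFin N ] (𝟙 ((π ⟨$⟩ʳ i) <ᶠ? (π ⟨$⟩ʳ j)) * edge (v ⟨$⟩ʳ i) (v ⟨$⟩ʳ j))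
    forwardEdges-flip-∘ π v =
      trans (forwardEdges-∑ (flip π ∘ₚ v))
      (trans (∑-permute _ π)
      (∑-cong (allFin N) λ i → trans (∑-permute _ π) (∑-cong (allFin N) λ j →
        cong (𝟙 ((π ⟨$⟩ʳ i) <ᶠ? (π ⟨$⟩ʳ j)) *_)
          (cong₂ (λ x y → edge (v ⟨$⟩ʳ x) (v ⟨$⟩ʳ y)) (inverseˡ π) (inverseˡ π)))))

  module _ {n} (T : Tournament (suc n)) (v : Ordering (suc n)) (p : Fin (suc n)) where
    private
      out into : Fin n → ℕ
      out j  = edge T (v ⟨$⟩ʳ p) (v ⟨$⟩ʳ punchIn p j)
      into j = edge T (v ⟨$⟩ʳ punchIn p j) (v ⟨$⟩ʳ p)

      rest : ℕ
      rest = ∑[ i ∈ allFin n ] ∑[ j ∈ allFin n ]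
        (𝟙 (i <ᶠ? j) * edge T (v ⟨$⟩ʳ punchIn p i) (v ⟨$⟩ʳ punchIn p j))

    -- Such a π moves v_p to position q and keeps the relative order of the others.
    forwardEdges-move : ∀ π q → π ⟨$⟩ʳ p ≡ q → (∀ j → π ⟨$⟩ʳ punchIn p j ≡ punchIn q j) →
      forwardEdges T (flip π ∘ₚ v) ≡
      (∑[ j ∈ allFin n ] (𝟙 (toℕ q ≤? toℕ j) * out j)) +
      ((∑[ j ∈ allFin n ] (𝟙 (toℕ j <? toℕ q) * into j)) + rest)
    forwardEdges-move π q πp πj =
      trans (forwardEdges-flip-∘ T π v)
      (trans (∑∑-punchIn p _)
      (cong₂ _+_
        (cong₂ _+_
          (cong (_* edge T (v ⟨$⟩ʳ p) (v ⟨$⟩ʳ p)) (𝟙-no ((π ⟨$⟩ʳ p) <ᶠ? (π ⟨$⟩ʳ p)) (<-irrefl refl)))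
          (∑-cong (allFin n) λ j → cong (_* out j)
            (trans (cong₂ (λ x y → 𝟙 (x <ᶠ? y)) πp (πj j))
                   (𝟙-cong (q <ᶠ? punchIn q j) (toℕ q ≤? toℕ j) (i<punchIn⁻ q j) (i<punchIn⁺ q j)))))
        (cong₂ _+_
          (∑-cong (allFin n) λ j → cong (_* into j)
            (trans (cong₂ (λ x y → 𝟙 (x <ᶠ? y)) (πj j) πp)
                   (𝟙-cong (punchIn q j <ᶠ? q) (toℕ j <? toℕ q) (punchIn<i⁻ q j) (punchIn<i⁺ q j))))
          (∑-cong (allFin n) λ i → ∑-cong (allFin n) λ j → cong (_* edge T _ _)
            (trans (cong₂ (λ x y → 𝟙 (x <ᶠ? y)) (πj i) (πj j)) (𝟙-punchIn-< q i j))))))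

    private
      between : Fin (suc n) → Fin n → ℕ
      between q j = 𝟙 ((toℕ q ≤? toℕ j) ×-dec (toℕ j <? toℕ p))

    -- Moving `v_p` to position `q` reverses the order of exactly the pairs it forms with the
    -- positions from `q` up to, but excluding, `p`. By maximality `v_p` has at most as many
    -- out-neighbours there as in-neighbours, and the two counts add up to `p - q`.
    inDegree-before : IsMedianOrder T v → ∀ q → q Fin.≤ p →
      toℕ p ≤ toℕ q + 2 * (∑[ j ∈ allFin n ] (𝟙 ((toℕ q ≤? toℕ j) ×-dec (toℕ j <? toℕ p)) * into j))
    inDegree-before median q q≤p = begin
      toℕ p ≡⟨ ∑-𝟙-interval q≤p (toℕ≤pred[n] p) ⟨
      toℕ q + ∑ (allFin n) (between q) ≡⟨ cong (toℕ q +_) total ⟩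
      toℕ q + (∑cout + ∑cin) ≤⟨ +-monoʳ-≤ (toℕ q) (+-monoˡ-≤ ∑cin out≤in) ⟩
      toℕ q + (∑cin + ∑cin) ≡⟨ cong (λ z → toℕ q + (∑cin + z)) (+-identityʳ ∑cin) ⟨
      toℕ q + 2 * ∑cin ∎
      where
      open ≤-Reasoning
      ∑cout ∑cin X Y : ℕ
      ∑cout = ∑[ j ∈ allFin n ] (between q j * out j)
      ∑cin = ∑[ j ∈ allFin n ] (between q j * into j)
      -- `X` and `Y` count the edges at `v_p` that are forward both before and after the move;
      -- together with `rest` they cancel in `out≤in`.
      X = ∑[ j ∈ allFin n ] (𝟙 (toℕ p ≤? toℕ j) * out j)
      Y = ∑[ j ∈ allFin n ] (𝟙 (toℕ j <? toℕ q) * into j)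
      total : ∑ (allFin n) (between q) ≡ ∑cout + ∑cin
      total = trans (∑-cong (allFin n) λ j →
        trans (sym (*-identityʳ _))
        (trans (cong (between q j *_) (sym (edge-sum T (punchInᵢ≢i p j ∘ sym ∘ v-injective))))
          (*-distribˡ-+ (between q j) (out j) (into j))))
        (∑-distrib-+ (allFin n) _ _)
        where
        v-injective : ∀ {x y} → v ⟨$⟩ʳ x ≡ v ⟨$⟩ʳ y → x ≡ y
        v-injective {x} {y} e = trans (sym (inverseˡ v)) (trans (cong (v ⟨$⟩ˡ_) e) (inverseˡ v))
      splitᵒ : ∑[ j ∈ allFin n ] (𝟙 (toℕ q ≤? toℕ j) * out j) ≡ X + ∑cout
      splitᵒ = trans (∑-cong (allFin n) λ j →
        trans (cong (_* out j) (𝟙-⊎ (toℕ q ≤? toℕ j) (toℕ p ≤? toℕ j) ((toℕ q ≤? toℕ j) ×-dec (toℕ j <? toℕ p))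
          (λ q≤j → case j q≤j (<-≤-connex (toℕ j) (toℕ p))) (≤-trans q≤p) proj₁
          (λ { p≤j (_ , j<p) → <⇒≱ j<p p≤j })))
        (*-distribʳ-+ (out j) (𝟙 (toℕ p ≤? toℕ j)) (between q j)))
        (∑-distrib-+ (allFin n) _ _)
        where
        case : ∀ j → toℕ q ≤ toℕ j → _ → _
        case j q≤j (inj₁ j<p) = inj₂ (q≤j , j<p)
        case j q≤j (inj₂ p≤j) = inj₁ p≤j
      splitⁱ : ∑[ j ∈ allFin n ] (𝟙 (toℕ j <? toℕ p) * into j) ≡ Y + ∑cin
      splitⁱ = trans (∑-cong (allFin n) λ j →
        trans (cong (_* into j) (𝟙-⊎ (toℕ j <? toℕ p) (toℕ j <? toℕ q) ((toℕ q ≤? toℕ j) ×-dec (toℕ j <? toℕ p))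
          (λ j<p → case j j<p (<-≤-connex (toℕ j) (toℕ q))) (λ j<q → <-≤-trans j<q q≤p) (λ { (_ , j<p) → j<p })
          (λ { j<q (q≤j , _) → <⇒≱ j<q q≤j })))
        (*-distribʳ-+ (into j) (𝟙 (toℕ j <? toℕ q)) (between q j)))
        (∑-distrib-+ (allFin n) _ _)
        where
        case : ∀ j → toℕ j < toℕ p → _ → _
        case j j<p (inj₁ j<q) = inj₁ j<q
        case j j<p (inj₂ q≤j) = inj₂ (q≤j , j<p)
      F[v] : forwardEdges T v ≡ X + ((Y + ∑cin) + rest)
      -- The original order is the trivial move from `p` to `p`, so one formula covers both orders.
      F[v] = trans (forwardEdges-move Perm.id p refl (λ _ → refl)) (cong (λ z → X + (z + rest)) splitⁱ)
      F[w] : forwardEdges T (flip (insert p q Perm.id) ∘ₚ v) ≡ (X + ∑cout) + (Y + rest)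
      F[w] = trans (forwardEdges-move (insert p q Perm.id) q (insert-self p q Perm.id) (insert-punchIn p q Perm.id))
                   (cong (_+ (Y + rest)) splitᵒ)
      out≤in : ∑cout ≤ ∑cin
      out≤in = +-cancelˡ-≤ (X + Y + rest) ∑cout ∑cin
        (subst₂ _≤_ (trans F[w] (regroupʷ X Y rest ∑cout)) (trans F[v] (regroupᵛ X Y rest ∑cin))
          (median (flip (insert p q Perm.id) ∘ₚ v)))
        where
        regroupʷ : ∀ x y r c → x + c + (y + r) ≡ x + y + r + c
        regroupʷ = solve-∀
        regroupᵛ : ∀ x y r c → x + (y + c + r) ≡ x + y + r + c
        regroupᵛ = solve-∀

  position-⟨$⟩ʳ : ∀ {N} (v : Ordering N) i → position v (v ⟨$⟩ʳ i) ≡ suc (toℕ i)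
  position-⟨$⟩ʳ v i = cong (suc ∘ toℕ) (inverseˡ v)

  -- The same bound in 1-based positions and as a sum over vertices, which is how intervals of the
  -- order are handled from here on.
  inDegree-median : ∀ {N} (T : Tournament N) (v : Ordering N) → IsMedianOrder T v →
    ∀ y i → 1 ≤ i → i ≤ position v y → position v y ≤ i + 2 *
      (∑[ x ∈ allFin N ] (𝟙 ((i ≤? position v x) ×-dec (position v x <? position v y)) * edge T x y))
  inDegree-median {suc n} T v median y (suc i) _ (s≤s i≤p) =
    ≤-trans (s≤s (inDegree-before T v p median q (≤-trans (≤-reflexive q≡i) i≤p)))
            (+-mono-≤ (s≤s (≤-reflexive q≡i)) (*-monoʳ-≤ 2 reindex))
    where
    open ≤-Reasoning
    p q : Fin (suc n)
    p = v ⟨$⟩ˡ y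
    i<1+n : i < suc n
    i<1+n = ≤-<-trans i≤p (toℕ<n p)
    q = fromℕ< i<1+n
    q≡i : toℕ q ≡ i
    q≡i = toℕ-fromℕ< i<1+n
    term : Fin (suc n) → ℕ
    term x = 𝟙 ((suc i ≤? position v x) ×-dec (position v x <? position v y)) * edge T x y
    pointwise : ∀ j → 𝟙 ((toℕ q ≤? toℕ j) ×-dec (toℕ j <? toℕ p)) * edge T (v ⟨$⟩ʳ punchIn p j) (v ⟨$⟩ʳ p)
                      ≤ term (v ⟨$⟩ʳ punchIn p j)
    pointwise j = *-mono-≤
      (𝟙-mono ((toℕ q ≤? toℕ j) ×-dec (toℕ j <? toℕ p)) ((suc i ≤? _) ×-dec (_ <? position v y))
        (λ (q≤j , j<p) →
          -- Because `j < p`, skipping `p` leaves the index `j` unchanged.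
          let pos≡ = trans (position-⟨$⟩ʳ v (punchIn p j)) (cong suc (toℕ-punchIn-< p j j<p)) in
          subst (suc i ≤_) (sym pos≡) (s≤s (subst (_≤ toℕ j) q≡i q≤j)) ,
          subst (_< position v y) (sym pos≡) (s<s j<p)))
      (≤-reflexive (cong (edge T (v ⟨$⟩ʳ punchIn p j)) (inverseʳ v)))
    reindex : ∑[ j ∈ allFin n ] (𝟙 ((toℕ q ≤? toℕ j) ×-dec (toℕ j <? toℕ p)) *
                                 edge T (v ⟨$⟩ʳ punchIn p j) (v ⟨$⟩ʳ p)) ≤ ∑ (allFin (suc n)) term
    reindex = begin
      ∑[ j ∈ allFin n ] (𝟙 ((toℕ q ≤? toℕ j) ×-dec (toℕ j <? toℕ p)) *
                         edge T (v ⟨$⟩ʳ punchIn p j) (v ⟨$⟩ʳ p)) ≤⟨ ∑-mono-≤ (allFin n) pointwise ⟩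
      -- The term of `y` itself is put back, which cannot decrease the sum.
      ∑[ j ∈ allFin n ] term (v ⟨$⟩ʳ punchIn p j) ≤⟨ m≤n+m _ (term (v ⟨$⟩ʳ p)) ⟩
      term (v ⟨$⟩ʳ p) + (∑[ j ∈ allFin n ] term (v ⟨$⟩ʳ punchIn p j)) ≡⟨ ∑-punchIn p (term ∘ (v ⟨$⟩ʳ_)) ⟨
      ∑[ x ∈ allFin (suc n) ] term (v ⟨$⟩ʳ x) ≡⟨ ∑-permute term v ⟨
      ∑ (allFin (suc n)) term ∎

-- A block of the order that sends many edges to `B`.

module Blocks where
  open import Defs
  open import Data.Fin.Base using (Fin; toℕ)
  open import Data.Fin.Permutation using (_⟨$⟩ʳ_)
  open import Data.Fin.Properties using (toℕ<n)
  open import Data.List.Base using (List; []; _∷_; allFin; length)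
  open import Data.List.Relation.Unary.All as All using (All; []; _∷_)
  open import Data.Nat.Base using (ℕ; zero; suc; _+_; _*_; _≤_; _<_; z≤n; s≤s)
  open import Data.Nat.Properties
  open import Data.Nat.Tactic.RingSolver using (solve-∀)
  open import Data.Product.Base using (_×_; _,_; ∃-syntax)
  open import Data.Sum.Base using (inj₁; inj₂)
  open import Relation.Binary.PropositionalEquality
  open import Relation.Nullary.Decidable using (_×-dec_)
  open FiniteSums
  open MedianOrders

  length*-≤-∑ : ∀ {A : Set} {c} {f : A → ℕ} {xs} → All (λ x → c ≤ f x) xs → length xs * c ≤ ∑ xs f
  length*-≤-∑ []         = z≤n
  length*-≤-∑ (px ∷ pxs) = +-mono-≤ px (length*-≤-∑ pxs)

  module _ {N} (v : Ordering N) where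

    within : ℕ → ℕ → Fin N → ℕ
    within i m x = 𝟙 ((i ≤? position v x) ×-dec (position v x <? m))

    ∑-within : ∀ {i m} → 1 ≤ i → i ≤ m → m ≤ suc N → i + ∑ (allFin N) (within i m) ≡ m
    ∑-within {suc i} {suc m} _ (s≤s i≤m) (s≤s m≤N) = cong suc (trans
      (cong (i +_) (trans (∑-permute (within (suc i) (suc m)) v) (∑-cong (allFin N) shift)))
      (∑-𝟙-interval i≤m m≤N))
      where
      shift : ∀ x → within (suc i) (suc m) (v ⟨$⟩ʳ x) ≡ 𝟙 ((i ≤? toℕ x) ×-dec (toℕ x <? m))
      shift x = trans
        (cong (λ z → 𝟙 ((suc i ≤? z) ×-dec (z <? suc m))) (position-⟨$⟩ʳ v x))
        (𝟙-cong ((suc i ≤? suc (toℕ x)) ×-dec (suc (toℕ x) <? suc m)) ((i ≤? toℕ x) ×-dec (toℕ x <? m))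
          (λ { (s≤s p , s≤s q) → p , q }) (λ (p , q) → s≤s p , s≤s q))

    within-split : ∀ {i j m} → i ≤ j → j ≤ m → ∀ x → within i m x ≡ within i j x + within j m x
    within-split {i} {j} {m} i≤j j≤m x =
      𝟙-⊎ ((i ≤? p) ×-dec (p <? m)) ((i ≤? p) ×-dec (p <? j)) ((j ≤? p) ×-dec (p <? m))
        (λ (i≤p , p<m) → case i≤p p<m (<-≤-connex p j))
        (λ (i≤p , p<j) → i≤p , <-≤-trans p<j j≤m)
        (λ (j≤p , p<m) → ≤-trans i≤j j≤p , p<m)
        (λ (_ , p<j) (j≤p , _) → <⇒≱ p<j j≤p)
      where
      p : ℕ
      p = position v x
      case : i ≤ p → p < m → _ → _
      case i≤p p<m (inj₁ p<j) = inj₁ (i≤p , p<j)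
      case i≤p p<m (inj₂ j≤p) = inj₂ (j≤p , p<m)

    weight : (Fin N → ℕ) → ℕ → ℕ → ℕ
    weight f i m = ∑[ x ∈ allFin N ] (within i m x * f x)

    weight-split : ∀ f {i j m} → i ≤ j → j ≤ m → weight f i m ≡ weight f i j + weight f j m
    weight-split f {i} {j} {m} i≤j j≤m = trans
      (∑-cong (allFin N) λ x →
        trans (cong (_* f x) (within-split i≤j j≤m x)) (*-distribʳ-+ (f x) (within i j x) (within j m x)))
      (∑-distrib-+ (allFin N) _ _)

    ∑-weight : ∀ (ys : List (Fin N)) (f : Fin N → Fin N → ℕ) i m →
      weight (λ x → ∑[ y ∈ ys ] f x y) i m ≡ ∑[ y ∈ ys ] weight (λ x → f x y) i m
    ∑-weight ys f i m = trans
      (∑-cong (allFin N) λ x → *-distribˡ-∑ (within i m x) ys (f x))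
      (∑-comm (allFin N) ys λ x y → within i m x * f x y)

    -- Let `p` be the position of `y`. Twice the in-degree of `y` from `[i,p)` is at least `p - i`,
    -- and at most `p - j` of these in-neighbours lie in `[j,p)`. So the in-degree from `[i,j)` is
    -- at least `(2j - p - i)/2`; with `p ≤ j + 2c` and `j - i = 2(k+1)c` this is at least `kc`. The
    -- `k` of the theorem is `suc k` here.
    inDegree-window : (T : Tournament N) → IsMedianOrder T v →
      ∀ y i c k a → 1 ≤ i → i + 2 * suc k * c ≤ position v y →
      position v y < i + 2 * suc k * c + a → a ≤ 2 * c →
      k * c ≤ weight (λ x → edge T x y) i (i + 2 * suc k * c)
    inDegree-window T median y i c k a 1≤i j≤p p<j+a a≤2c =
      -- Doubling and adding a common term remove every subtraction from this computation.
      *-cancelˡ-≤ 2 (+-cancelʳ-≤ (i + 2 * j + p + 2 * c) (2 * (k * c)) (2 * D) (begin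
        2 * (k * c) + (i + 2 * j + p + 2 * c)   ≡⟨ regroup₁ i c k j p ⟩
        j + (p + 2 * j)                         ≤⟨ +-monoʳ-≤ j (+-monoˡ-≤ (2 * j) p≤) ⟩
        j + (i + 2 * (D + e) + 2 * j)           ≡⟨ regroup₂ i j D e ⟩
        j + i + 2 * D + 2 * (j + e)             ≤⟨ +-monoʳ-≤ (j + i + 2 * D) (*-monoʳ-≤ 2 j+e≤p) ⟩
        j + i + 2 * D + 2 * p                   ≡⟨ regroup₃ i j D p ⟩
        i + j + 2 * D + p + p                   ≤⟨ +-monoʳ-≤ (i + j + 2 * D + p) p≤j+2c ⟩
        i + j + 2 * D + p + (j + 2 * c)         ≡⟨ regroup₄ i j D p c ⟩
        2 * D + (i + 2 * j + p + 2 * c)         ∎))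
      where
      open ≤-Reasoning
      f : Fin N → ℕ
      f x = edge T x y
      j p D e : ℕ
      j = i + 2 * suc k * c
      p = position v y
      D = weight f i j
      e = weight f j p
      i≤j : i ≤ j
      i≤j = m≤m+n i _
      p≤ : p ≤ i + 2 * (D + e)
      p≤ = subst (λ w → p ≤ i + 2 * w) (weight-split f i≤j j≤p)
             (inDegree-median T v median y i 1≤i (≤-trans i≤j j≤p))
      p≤j+2c : p ≤ j + 2 * c
      p≤j+2c = ≤-trans (<⇒≤ p<j+a) (+-monoʳ-≤ j a≤2c)
      j+e≤p : j + e ≤ p
      j+e≤p = ≤-trans
        (+-monoʳ-≤ j (∑-mono-≤ (allFin N) λ x →
          subst (within j p x * f x ≤_) (*-identityʳ _) (*-monoʳ-≤ (within j p x) (𝟙≤1 (Tournament._⟶?_ T x y)))))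
        (≤-reflexive (∑-within (≤-trans 1≤i i≤j) j≤p (m≤n⇒m≤1+n (toℕ<n _))))
      regroup₁ : ∀ i c k j p → 2 * (k * c) + (i + 2 * j + p + 2 * c) ≡ (i + 2 * suc k * c) + (p + 2 * j)
      regroup₁ = solve-∀
      regroup₂ : ∀ i j D e → j + (i + 2 * (D + e) + 2 * j) ≡ j + i + 2 * D + 2 * (j + e)
      regroup₂ = solve-∀
      regroup₃ : ∀ i j D p → j + i + 2 * D + 2 * p ≡ i + j + 2 * D + p + p
      regroup₃ = solve-∀
      regroup₄ : ∀ i j D p c → i + j + 2 * D + p + (j + 2 * c) ≡ 2 * D + (i + 2 * j + p + 2 * c)
      regroup₄ = solve-∀

    -- Pigeonhole by induction on the number `suc m` of blocks: if the first block weighs at most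
    -- `w / r`, the others still average at least `w / r`. The factor `r` clears the denominator.
    heavy-block : ∀ f c r w m i → suc m * w ≤ r * weight f i (i + suc m * c) →
      ∃[ i′ ] i ≤ i′ × i′ + c ≤ i + suc m * c × w ≤ r * weight f i′ (i′ + c)
    heavy-block f c r w zero i h =
      i , ≤-refl , ≤-reflexive (sym i+1c) , subst₂ _≤_ (*-identityˡ w) (cong (λ z → r * weight f i z) i+1c) h
      where
      i+1c : i + 1 * c ≡ i + c
      i+1c = cong (i +_) (*-identityˡ c)
    heavy-block f c r w (suc m) i h with ≤-total w (r * weight f i (i + c))
    ... | inj₁ w≤ = i , ≤-refl , +-monoʳ-≤ i (m≤m+n c _) , w≤
    ... | inj₂ ≤w =
      let i′ , i+c≤i′ , i′+c≤ , w≤ = heavy-block f c r w m (i + c) remaining in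
      i′ , ≤-trans (m≤m+n i c) i+c≤i′ , subst (i′ + c ≤_) shift i′+c≤ , w≤
      where
      open ≤-Reasoning
      shift : i + c + suc m * c ≡ i + suc (suc m) * c
      shift = +-assoc i c (suc m * c)
      W : ℕ
      W = weight f (i + c) (i + c + suc m * c)
      remaining : suc m * w ≤ r * W
      remaining = +-cancelˡ-≤ w _ _ (begin
        w + suc m * w                           ≤⟨ h ⟩
        r * weight f i (i + suc (suc m) * c)    ≡⟨ cong (λ z → r * weight f i z) shift ⟨
        r * weight f i (i + c + suc m * c)      ≡⟨ cong (r *_) (weight-split f (m≤m+n i c) (m≤m+n (i + c) _)) ⟩
        r * (weight f i (i + c) + W)            ≡⟨ *-distribˡ-+ r (weight f i (i + c)) W ⟩
        r * weight f i (i + c) + r * W          ≤⟨ +-monoˡ-≤ (r * W) ≤w ⟩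
        w + r * W                               ∎)

    dense-block : (T : Tournament N) → IsMedianOrder T v → ∀ i c k a → 1 ≤ i → a ≤ 2 * c →
      (ys : List (Fin N)) →
      All (λ y → i + 2 * suc k * c ≤ position v y × position v y < i + 2 * suc k * c + a) ys →
      ∃[ i′ ] i ≤ i′ × i′ + c ≤ i + 2 * suc k * c ×
        length ys * (k * c) ≤ 2 * suc k * weight (λ x → ∑[ y ∈ ys ] edge T x y) i′ (i′ + c)
    dense-block T median i c k a 1≤i a≤2c ys after =
      -- The window consists of `2 * suc k` blocks, a number that unfolds to `suc (k + 1 * suc k)`;
      -- the same number is the factor `r`.
      heavy-block (λ x → ∑[ y ∈ ys ] edge T x y) c (2 * suc k) (length ys * (k * c)) (k + 1 * suc k) i
        (*-monoʳ-≤ (2 * suc k) (≤-trans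
          (length*-≤-∑ (All.map (λ {y} (j≤y , y<j+a) → inDegree-window T median y i c k a 1≤i j≤y y<j+a a≤2c) after))
          (≤-reflexive (sym (∑-weight ys (edge T) i (i + 2 * suc k * c))))))

-- The power mean inequality over the natural numbers.

module PowerMean where
  open import Data.List.Base using (List; length)
  open import Data.Nat.Base using (ℕ; zero; suc; _+_; _*_; _^_; _≤_)
  open import Data.Nat.Properties
  open import Data.Nat.Tactic.RingSolver using (solve-∀)
  open import Data.Product.Base using (_,_)
  open import Data.Sum.Base using (inj₁; inj₂)
  open import Relation.Binary.PropositionalEquality
  open FiniteSums
  open ≤-Reasoning

  ^-distribʳ-* : ∀ ℓ x y → (x * y) ^ ℓ ≡ x ^ ℓ * y ^ ℓ
  ^-distribʳ-* zero    x y = refl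
  ^-distribʳ-* (suc ℓ) x y =
    trans (cong (x * y *_) (^-distribʳ-* ℓ x y)) (interchange x y (x ^ ℓ) (y ^ ℓ))
    where
    interchange : ∀ x y u w → x * y * (u * w) ≡ x * u * (y * w)
    interchange = solve-∀

  2xy≤x²+y² : ∀ x y → 2 * (x * y) ≤ x * x + y * y
  2xy≤x²+y² x y with ≤-total x y
  ... | inj₁ x≤y with d , refl ← m≤n⇒∃[o]m+o≡n x≤y = ≤-trans (m≤m+n _ (d * d)) (≤-reflexive (expand x d))
    where
    expand : ∀ x d → 2 * (x * (x + d)) + d * d ≡ x * x + (x + d) * (x + d)
    expand = solve-∀
  ... | inj₂ y≤x with d , refl ← m≤n⇒∃[o]m+o≡n y≤x = ≤-trans (m≤m+n _ (d * d)) (≤-reflexive (expand y d))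
    where
    expand : ∀ y d → 2 * ((y + d) * y) + d * d ≡ (y + d) * (y + d) + y * y
    expand = solve-∀

  -- x ↦ x^(m+1) lies above its tangent at t, with both sides arranged so that
  -- no subtraction occurs.
  tangent : ∀ m x t → suc m * (x * t ^ m) ≤ x ^ suc m + m * t ^ suc m
  tangent zero    x t = ≤-reflexive (base x)
    where
    base : ∀ x → 1 * (x * 1) ≡ x * 1 + 0
    base = solve-∀
  -- Adds `x` times the inequality for `m` to `suc m * t ^ m` times `2xt ≤ x² + t²`, then cancels
  -- the mixed terms common to both sides.
  tangent (suc m) x t = +-cancelʳ-≤ (suc m * (x * x * t ^ m) + m * (x * (t * t ^ m))) _ _ (begin
    suc (suc m) * (x * (t * t ^ m)) + (suc m * (x * x * t ^ m) + m * (x * (t * t ^ m)))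
      ≡⟨ regroup₁ m x t (t ^ m) ⟩
    x * (suc m * (x * t ^ m)) + suc m * t ^ m * (2 * (x * t))
      ≤⟨ +-mono-≤ (*-monoʳ-≤ x (tangent m x t)) (*-monoʳ-≤ (suc m * t ^ m) (2xy≤x²+y² x t)) ⟩
    x * (x ^ suc m + m * (t * t ^ m)) + suc m * t ^ m * (x * x + t * t)
      ≡⟨ regroup₂ m x t (t ^ m) (x ^ suc m) ⟩
    x * x ^ suc m + suc m * (t * (t * t ^ m)) + (suc m * (x * x * t ^ m) + m * (x * (t * t ^ m))) ∎)
    where
    regroup₁ : ∀ m x t u → suc (suc m) * (x * (t * u)) + (suc m * (x * x * u) + m * (x * (t * u))) ≡
                           x * (suc m * (x * u)) + suc m * u * (2 * (x * t))
    regroup₁ = solve-∀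
    regroup₂ : ∀ m x t u w → x * (w + m * (t * u)) + suc m * u * (x * x + t * t) ≡
               x * w + suc m * (t * (t * u)) + (suc m * (x * x * u) + m * (x * (t * u)))
    regroup₂ = solve-∀

  -- Sum the tangent inequality at `t` over the list. Any lower bound `t` for the mean will do, so
  -- the mean itself need not be a natural number.
  power-mean : ∀ {A : Set} (xs : List A) (f : A → ℕ) t ℓ →
    length xs * t ≤ ∑ xs f → length xs * t ^ ℓ ≤ ∑[ x ∈ xs ] (f x ^ ℓ)
  power-mean xs f t zero    h = ≤-reflexive (sym (∑-const xs 1))
  power-mean xs f t (suc m) h = +-cancelʳ-≤ (length xs * (m * t ^ suc m)) _ _ (begin
    length xs * t ^ suc m + length xs * (m * t ^ suc m)  ≡⟨ regroup (length xs) m t (t ^ m) ⟩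
    suc m * t ^ m * (length xs * t)                      ≤⟨ *-monoʳ-≤ (suc m * t ^ m) h ⟩
    suc m * t ^ m * ∑ xs f                               ≡⟨ *-distribˡ-∑ (suc m * t ^ m) xs f ⟩
    ∑[ x ∈ xs ] (suc m * t ^ m * f x)                    ≡⟨ ∑-cong xs (λ x → swap (suc m) (t ^ m) (f x)) ⟩
    ∑[ x ∈ xs ] (suc m * (f x * t ^ m))                  ≤⟨ ∑-mono-≤ xs (λ x → tangent m (f x) t) ⟩
    ∑[ x ∈ xs ] (f x ^ suc m + m * t ^ suc m)            ≡⟨ ∑-distrib-+ xs _ _ ⟩
    (∑[ x ∈ xs ] (f x ^ suc m)) + (∑[ _ ∈ xs ] (m * t ^ suc m))
      ≡⟨ cong ((∑[ x ∈ xs ] (f x ^ suc m)) +_) (∑-const xs (m * t ^ suc m)) ⟩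
    (∑[ x ∈ xs ] (f x ^ suc m)) + length xs * (m * t ^ suc m) ∎)
    where
    regroup : ∀ n m t u → n * (t * u) + n * (m * (t * u)) ≡ suc m * u * (n * t)
    regroup = solve-∀
    swap : ∀ m u z → m * u * z ≡ m * (z * u)
    swap = solve-∀

-- Uniform tuples and the first-moment argument.

module Averaging where
  open import Data.List.Base using (List; []; _∷_; length; cartesianProductWith)
  open import Data.List.Relation.Unary.All using ([]; _∷_; all?)
  open import Data.Nat.Base using (ℕ; zero; suc; _+_; _*_; _^_; _≤_; z≤n; NonZero)
  open import Data.Nat.Properties
  open import Data.Nat.Tactic.RingSolver using (solve-∀)
  open import Data.Product.Base using (_×_; _,_; ∃-syntax)
  open import Data.Sum.Base using (_⊎_; inj₁; inj₂)
  open import Relation.Binary.PropositionalEquality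
  open import Relation.Nullary.Decidable using (yes; no)
  open import Relation.Nullary.Negation using (contradiction)
  open import Relation.Unary using (Pred; Decidable)
  open FiniteSums

  -- Ordered tuples with repetition allowed, so that counting them models independent uniform
  -- choices of the entries.
  tuples : {A : Set} → List A → ℕ → List (List A)
  tuples xs zero    = [] ∷ []
  tuples xs (suc ℓ) = cartesianProductWith _∷_ xs (tuples xs ℓ)

  length-tuples : ∀ {A : Set} (xs : List A) ℓ → length (tuples xs ℓ) ≡ length xs ^ ℓ
  length-tuples xs ℓ = trans (sym (trans (∑-const (tuples xs ℓ) 1) (*-identityʳ _))) (go ℓ)
    where
    go : ∀ ℓ → ∑[ _ ∈ tuples xs ℓ ] 1 ≡ length xs ^ ℓ
    go zero    = refl
    go (suc ℓ) = trans (∑-cartesianProductWith _∷_ xs (tuples xs ℓ) _)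
      (trans (∑-const xs _) (cong (length xs *_) (go ℓ)))

  -- Independence of the entries: splitting off the first one factors the count.
  ∑-tuples-all : ∀ {A : Set} {p} {P : Pred A p} (P? : Decidable P) (xs : List A) ℓ →
    ∑[ t ∈ tuples xs ℓ ] 𝟙 (all? P? t) ≡ (∑[ x ∈ xs ] 𝟙 (P? x)) ^ ℓ
  ∑-tuples-all P? xs zero    = refl
  ∑-tuples-all P? xs (suc ℓ) = begin
    ∑[ t ∈ tuples xs (suc ℓ) ] 𝟙 (all? P? t)
      ≡⟨ ∑-cartesianProductWith _∷_ xs (tuples xs ℓ) _ ⟩
    ∑[ x ∈ xs ] ∑[ t ∈ tuples xs ℓ ] 𝟙 (all? P? (x ∷ t))
      ≡⟨ ∑-cong xs (λ x → trans (∑-cong (tuples xs ℓ) λ t → head*tail x t)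
           (sym (*-distribˡ-∑ (𝟙 (P? x)) (tuples xs ℓ) _))) ⟩
    ∑[ x ∈ xs ] (𝟙 (P? x) * ∑ (tuples xs ℓ) (λ t → 𝟙 (all? P? t)))
      ≡⟨ *-distribʳ-∑ (∑ (tuples xs ℓ) (λ t → 𝟙 (all? P? t))) xs (λ x → 𝟙 (P? x)) ⟨
    ∑ xs (λ x → 𝟙 (P? x)) * ∑ (tuples xs ℓ) (λ t → 𝟙 (all? P? t))
      ≡⟨ cong (∑ xs (λ x → 𝟙 (P? x)) *_) (∑-tuples-all P? xs ℓ) ⟩
    ∑ xs (λ x → 𝟙 (P? x)) * ∑ xs (λ x → 𝟙 (P? x)) ^ ℓ ∎
    where
    open ≡-Reasoning
    head*tail : ∀ x t → 𝟙 (all? P? (x ∷ t)) ≡ 𝟙 (P? x) * 𝟙 (all? P? t)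
    head*tail x t with P? x | all? P? t
    ... | yes _ | yes _ = refl
    ... | yes _ | no _  = refl
    ... | no _  | yes _ = refl
    ... | no _  | no _  = refl

  -- The constructive core of averaging: a search along the list either meets a witness or collects
  -- inequalities that can be added up.
  ∃⊎∑≤ : ∀ {A : Set} {p} {P : Pred A p} (xs : List A) (f g : A → ℕ) →
    (∀ x → P x ⊎ f x ≤ g x) → (∃[ x ] P x) ⊎ ∑ xs f ≤ ∑ xs g
  ∃⊎∑≤ []       f g h = inj₂ z≤n
  ∃⊎∑≤ (x ∷ xs) f g h with h x | ∃⊎∑≤ xs f g h
  ... | inj₁ px | _        = inj₁ (x , px)
  ... | inj₂ _  | inj₁ ∃P  = inj₁ ∃P
  ... | inj₂ p  | inj₂ q   = inj₂ (+-mono-≤ p q)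

  -- With M = 4RK + 1, a choice violating one of the two bounds satisfies
  -- 2RM·X ≤ cQM + 2RcQn·Y; summing this over all choices contradicts the means.
  averaging : ∀ {A : Set} (xs : List A) (X Y : A → ℕ) c Q R K →
    .{{NonZero c}} → .{{NonZero Q}} → .{{NonZero (length xs)}} →
    (∀ x → X x ≤ c) → c * Q * length xs ≤ R * ∑ xs X → ∑ xs Y ≤ K →
    ∃[ x ] c * Q ≤ 2 * R * X x × Y x * Q * length xs ≤ 4 * R * K
  averaging xs X Y c Q R K X≤c meanX meanY = conclude (∃⊎∑≤ xs _ _ good⊎)
    where
    open ≤-Reasoning
    n M : ℕ
    n = length xs
    M = suc (4 * R * K)
    Good : _ → Set
    Good x = c * Q ≤ 2 * R * X x × Y x * Q * n ≤ 4 * R * K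
    good⊎ : ∀ x → Good x ⊎ 2 * R * M * X x ≤ c * Q * M + 2 * R * c * Q * n * Y x
    good⊎ x with c * Q ≤? 2 * R * X x | Y x * Q * n ≤? 4 * R * K
    ... | yes p | yes q = inj₁ (p , q)
    ... | no ¬p | _     = inj₂ (begin
      2 * R * M * X x     ≡⟨ swap R M (X x) ⟩
      2 * R * X x * M     ≤⟨ *-monoˡ-≤ M (<⇒≤ (≰⇒> ¬p)) ⟩
      c * Q * M           ≤⟨ m≤m+n _ _ ⟩
      c * Q * M + 2 * R * c * Q * n * Y x ∎)
      where
      swap : ∀ R M X → 2 * R * M * X ≡ 2 * R * X * M
      swap = solve-∀
    ... | yes _ | no ¬q = inj₂ (begin
      -- The failed bound says `M ≤ Y x * Q * n`, since `M` is the successor of its right-hand side.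
      2 * R * M * X x                 ≤⟨ *-mono-≤ (*-monoʳ-≤ (2 * R) (≰⇒> ¬q)) (X≤c x) ⟩
      2 * R * (Y x * Q * n) * c       ≡⟨ swap R (Y x) Q n c ⟩
      2 * R * c * Q * n * Y x         ≤⟨ m≤n+m _ _ ⟩
      c * Q * M + 2 * R * c * Q * n * Y x ∎)
      where
      swap : ∀ R Y Q n c → 2 * R * (Y * Q * n) * c ≡ 2 * R * c * Q * n * Y
      swap = solve-∀
    conclude : (∃[ x ] Good x) ⊎ _ → ∃[ x ] Good x
    conclude (inj₁ good) = good
    -- With both means inserted and `c * Q * n` cancelled, the sum reads `2M ≤ M + 2RK`, which is
    -- impossible because `M > 4RK`.
    conclude (inj₂ bad)  = contradiction (*-cancelˡ-≤ (c * Q * n) {{nz}} (begin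
      c * Q * n * (2 * M)                        ≡⟨ swap₁ (c * Q * n) M ⟩
      2 * M * (c * Q * n)                        ≤⟨ *-monoʳ-≤ (2 * M) meanX ⟩
      2 * M * (R * ∑ xs X)                       ≡⟨ swap₂ M R (∑ xs X) ⟩
      2 * R * M * ∑ xs X                         ≡⟨ *-distribˡ-∑ (2 * R * M) xs X ⟩
      ∑[ x ∈ xs ] (2 * R * M * X x)              ≤⟨ bad ⟩
      ∑[ x ∈ xs ] (c * Q * M + 2 * R * c * Q * n * Y x)
        ≡⟨ trans (∑-distrib-+ xs _ _) (cong₂ _+_ (∑-const xs _) (sym (*-distribˡ-∑ (2 * R * c * Q * n) xs Y))) ⟩
      n * (c * Q * M) + 2 * R * c * Q * n * ∑ xs Y
        ≤⟨ +-monoʳ-≤ (n * (c * Q * M)) (*-monoʳ-≤ (2 * R * c * Q * n) meanY) ⟩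
      n * (c * Q * M) + 2 * R * c * Q * n * K     ≡⟨ swap₃ n c Q M R K ⟩
      c * Q * n * (M + 2 * R * K) ∎)) (<⇒≱ (begin-strict
      M + 2 * R * K                               ≤⟨ +-monoʳ-≤ M (≤-trans (m≤m+n _ _) (≤-reflexive (swap₄ R K))) ⟩
      M + 4 * R * K                               <⟨ +-monoʳ-< M ≤-refl ⟩
      M + M                                       ≡⟨ cong (M +_) (+-identityʳ M) ⟨
      2 * M ∎))
      where
      nz : NonZero (c * Q * n)
      nz = m*n≢0 (c * Q) n {{m*n≢0 c Q}}
      swap₁ : ∀ z M → z * (2 * M) ≡ 2 * M * z
      swap₁ = solve-∀
      swap₂ : ∀ M R S → 2 * M * (R * S) ≡ 2 * R * M * S
      swap₂ = solve-∀
      swap₃ : ∀ n c Q M R K → n * (c * Q * M) + 2 * R * c * Q * n * K ≡ c * Q * n * (M + 2 * R * K)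
      swap₃ = solve-∀
      swap₄ : ∀ R K → 2 * R * K + 2 * R * K ≡ 4 * R * K
      swap₄ = solve-∀

-- Dependent random choice.

module DependentRandomChoice where
  open import Defs
  open import Data.Bool.Base using (true; false)
  open import Data.Fin.Base using (Fin; zero; suc)
  open import Data.Fin.Properties using () renaming (all? to allFin?)
  open import Data.Fin.Subset using (Subset; _∈_; _⊆_; _∩_; ∣_∣)
  open import Data.Fin.Subset.Properties
    using (_∈?_; _⊆?_; drop-there; drop-∷-⊆; s⊆s; out⊆; x∈p∩q⁺; x∈p∩q⁻; ⊆-trans; p⊆q⇒∣p∣≤∣q∣)
  open import Data.List.Base using (List; []; _∷_; map; filter; length; allFin)
  open import Data.List.Relation.Unary.All as All using (All; []; _∷_; all?)
  open import Data.Nat.Base using (ℕ; zero; suc; _+_; _*_; _^_; _≤_; _<_; _≥_; z≤n; s≤s; NonZero)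
  open import Data.Nat.Combinatorics using (_C_; nCk≡nC[n∸k]; nCn≡1; k>n⇒nCk≡0; nCk+nC[k+1]≡[n+1]C[k+1])
  open import Data.Nat.Properties
  open import Data.Product.Base using (_×_; _,_; proj₁; proj₂; ∃-syntax)
  open import Data.Vec.Base using ([]; _∷_; here; there)
  open import Data.Vec.Properties using ([]=⇒lookup; lookup⇒[]=; lookup∘tabulate)
  open import Function.Base using (_∘_; it)
  open import Level using (0ℓ)
  open import Relation.Binary.PropositionalEquality
  open import Relation.Nullary.Decidable using (Dec; yes; no; does; ¬?; _×-dec_; dec-true; _→-dec_)
  open import Relation.Nullary.Negation using (¬_; contradiction)
  open import Relation.Unary using (Pred; Decidable)
  open FiniteSums
  open MedianOrders
  open PowerMean
  open Averaging

  module _ {n} {P : Pred (Fin n) 0ℓ} (P? : Decidable P) {x : Fin n} where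

    ∈-comprehension⁺ : P x → x ∈ comprehension P?
    ∈-comprehension⁺ px = lookup⇒[]= x _ (trans (lookup∘tabulate (does ∘ P?) x) (dec-true (P? x) px))

    ∈-comprehension⁻ : x ∈ comprehension P? → P x
    ∈-comprehension⁻ x∈ with P? x | trans (sym (lookup∘tabulate (does ∘ P?) x)) ([]=⇒lookup x∈)
    ... | yes px | _  = px
    ... | no _   | ()

  ∣∣-∑ : ∀ {n} (S : Subset n) → ∣ S ∣ ≡ ∑[ x ∈ allFin n ] 𝟙 (x ∈? S)
  ∣∣-∑ []      = refl
  ∣∣-∑ {suc n} (b ∷ S) = trans (lemma b) (sym (∑-allFin-suc λ x → 𝟙 (x ∈? (b ∷ S))))
    where
    tail : ∣ S ∣ ≡ ∑[ x ∈ allFin n ] 𝟙 (suc x ∈? (b ∷ S))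
    tail = trans (∣∣-∑ S) (∑-cong (allFin n) λ x → 𝟙-cong (x ∈? S) (suc x ∈? (b ∷ S)) there drop-there)
    lemma : ∀ b → ∣ b ∷ S ∣ ≡ 𝟙 (zero ∈? (b ∷ S)) + ∑[ x ∈ allFin n ] 𝟙 (suc x ∈? (b ∷ S))
    lemma true  = cong suc tail
    lemma false = tail

  nC0≡1 : ∀ n → n C 0 ≡ 1
  nC0≡1 n = trans (nCk≡nC[n∸k] {n = n} z≤n) (nCn≡1 n)

  -- Induction according to whether `S` contains the first element of the ground set; if `A`
  -- contains it, this is Pascal's rule.
  ∑-subsets : ∀ {n} (A : Subset n) d →
    ∑[ S ∈ allSubsets n ] 𝟙 ((S ⊆? A) ×-dec (∣ S ∣ ≟ d)) ≡ ∣ A ∣ C d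
  ∑-subsets []      zero    = refl
  ∑-subsets []      (suc d) = sym (k>n⇒nCk≡0 {0} {suc d} (s≤s z≤n))
  ∑-subsets {suc n} (b ∷ A) d = trans
    (trans (∑-++ (map (true ∷_) (allSubsets n)) _ _)
      (cong₂ _+_ (∑-map (allSubsets n) (true ∷_) _)
        (trans (∑-map (allSubsets n) (false ∷_) _) (trans without (∑-subsets A d)))))
    (with-head b d)
    where
    without : ∑[ S ∈ allSubsets n ] 𝟙 (((false ∷ S) ⊆? (b ∷ A)) ×-dec (∣ S ∣ ≟ d)) ≡
              ∑[ S ∈ allSubsets n ] 𝟙 ((S ⊆? A) ×-dec (∣ S ∣ ≟ d))
    without = ∑-cong (allSubsets n) λ S →
      𝟙-cong (((false ∷ S) ⊆? (b ∷ A)) ×-dec (∣ S ∣ ≟ d)) ((S ⊆? A) ×-dec (∣ S ∣ ≟ d))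
        (λ (S⊆A , ∣S∣≡d) → drop-∷-⊆ S⊆A , ∣S∣≡d) (λ (S⊆A , ∣S∣≡d) → out⊆ S⊆A , ∣S∣≡d)
    none : ∀ b d → (∀ S → ¬ (((true ∷ S) ⊆ (b ∷ A)) × suc ∣ S ∣ ≡ d)) →
      ∑[ S ∈ allSubsets n ] 𝟙 (((true ∷ S) ⊆? (b ∷ A)) ×-dec (suc ∣ S ∣ ≟ d)) ≡ 0
    none b d ¬p = trans
      (∑-cong (allSubsets n) λ S → 𝟙-no (((true ∷ S) ⊆? (b ∷ A)) ×-dec (suc ∣ S ∣ ≟ d)) (¬p S))
      (∑-zero (allSubsets n))
    with-head : ∀ b d →
      ∑[ S ∈ allSubsets n ] 𝟙 (((true ∷ S) ⊆? (b ∷ A)) ×-dec (suc ∣ S ∣ ≟ d)) + ∣ A ∣ C d ≡ ∣ b ∷ A ∣ C d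
    with-head false d       = cong (_+ ∣ A ∣ C d) (none false d λ S (S⊆A , _) → contradiction (S⊆A here) λ ())
    with-head true  zero    = trans (cong (_+ ∣ A ∣ C 0) (none true zero λ S ()))
                                    (trans (nC0≡1 ∣ A ∣) (sym (nC0≡1 (suc ∣ A ∣))))
    with-head true  (suc d) = trans
      (cong (_+ ∣ A ∣ C suc d) (trans
        (∑-cong (allSubsets n) λ S →
          𝟙-cong (((true ∷ S) ⊆? (true ∷ A)) ×-dec (suc ∣ S ∣ ≟ suc d)) ((S ⊆? A) ×-dec (∣ S ∣ ≟ d))
            (λ (S⊆A , ∣S∣≡d) → drop-∷-⊆ S⊆A , suc-injective ∣S∣≡d) (λ (S⊆A , ∣S∣≡d) → s⊆s S⊆A , cong suc ∣S∣≡d))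
        (∑-subsets A d)))
      (nCk+nC[k+1]≡[n+1]C[k+1] ∣ A ∣ d)

  members : ∀ {N} → Subset N → List (Fin N)
  members {N} S = filter (_∈? S) (allFin N)

  length-members : ∀ {N} (S : Subset N) → length (members S) ≡ ∣ S ∣
  length-members {N} S = trans (length-filter-∑ (_∈? S) (allFin N)) (sym (∣∣-∑ S))

  module _ {N} (T : Tournament N) (U B : Subset N) where
    open Tournament T

    private
      degree : Fin N → ℕ
      degree x = ∑[ y ∈ members B ] edge T x y

    sources? : (t : List (Fin N)) → Decidable (λ x → x ∈ U × All (x ⟶_) t)
    sources? t x = (x ∈? U) ×-dec all? (x ⟶?_) t

    -- The random set of the method: the common in-neighbourhood of the tuple inside `U`.
    sources : List (Fin N) → Subset N
    sources t = comprehension (sources? t)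

    sources⊆ : ∀ t → sources t ⊆ U
    sources⊆ t = proj₁ ∘ ∈-comprehension⁻ (sources? t)

    -- Double counting: a vertex `x` of `U` lies in `sources t` exactly when all entries of `t` are
    -- out-neighbours of `x`, which holds for `degree x ^ ℓ` tuples.
    ∑-∣sources∣ : ∀ ℓ → ∑[ t ∈ tuples (members B) ℓ ] ∣ sources t ∣ ≡ ∑[ x ∈ members U ] (degree x ^ ℓ)
    ∑-∣sources∣ ℓ = begin
      ∑[ t ∈ ts ] ∣ sources t ∣
        ≡⟨ ∑-cong ts (λ t → trans (∣∣-∑ (sources t)) (∑-cong (allFin N) λ x →
             trans (𝟙-cong (x ∈? sources t) (sources? t x)
                     (∈-comprehension⁻ (sources? t)) (∈-comprehension⁺ (sources? t)))
                   (𝟙-× (x ∈? U) (all? (x ⟶?_) t)))) ⟩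
      ∑[ t ∈ ts ] ∑[ x ∈ allFin N ] (𝟙 (x ∈? U) * 𝟙 (all? (x ⟶?_) t))
        ≡⟨ ∑-comm ts (allFin N) (λ t x → 𝟙 (x ∈? U) * 𝟙 (all? (x ⟶?_) t)) ⟩
      ∑[ x ∈ allFin N ] ∑[ t ∈ ts ] (𝟙 (x ∈? U) * 𝟙 (all? (x ⟶?_) t))
        ≡⟨ ∑-cong (allFin N) (λ x → trans (sym (*-distribˡ-∑ (𝟙 (x ∈? U)) ts _))
             (cong (𝟙 (x ∈? U) *_) (∑-tuples-all (x ⟶?_) (members B) ℓ))) ⟩
      ∑[ x ∈ allFin N ] (𝟙 (x ∈? U) * degree x ^ ℓ)
        ≡⟨ ∑-filter (_∈? U) (allFin N) (λ x → degree x ^ ℓ) ⟨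
      ∑[ x ∈ members U ] (degree x ^ ℓ) ∎
      where
      open ≡-Reasoning
      ts : List (List (Fin N))
      ts = tuples (members B) ℓ

    module _ (s Δ : ℕ) where

      rich? : Decidable (λ S → ∣ N⁺ T S ∩ B ∣ ≥ s + 1)
      rich? S = ∣ N⁺ T S ∩ B ∣ ≥? s + 1

      -- This limits the tuples for which `S` survives: their entries must all be common
      -- out-neighbours of `S`.
      common⊆ : ∀ {S t} → S ⊆ sources t → All (_∈ N⁺ T S) t
      common⊆ {S} {t} S⊆ = All.tabulate λ {y} y∈t →
        ∈-comprehension⁺ (λ y → allFin? (λ x → (x ∈? S) →-dec (x ⟶? y)))
          λ x x∈S → All.lookup (proj₂ (∈-comprehension⁻ (sources? t) (S⊆ x∈S))) y∈t

      ∑-𝟙-N⁺ : ∀ S → ∑[ y ∈ members B ] 𝟙 (y ∈? N⁺ T S) ≡ ∣ N⁺ T S ∩ B ∣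
      ∑-𝟙-N⁺ S = trans (∑-filter (_∈? B) (allFin N) _) (trans
        (∑-cong (allFin N) λ y → trans (sym (𝟙-× (y ∈? B) (y ∈? N⁺ T S)))
          (𝟙-cong ((y ∈? B) ×-dec (y ∈? N⁺ T S)) (y ∈? (N⁺ T S ∩ B))
            (λ (y∈B , y∈N) → x∈p∩q⁺ (y∈N , y∈B))
            (λ y∈ → let y∈N , y∈B = x∈p∩q⁻ (N⁺ T S) B y∈ in y∈B , y∈N)))
        (sym (∣∣-∑ (N⁺ T S ∩ B))))

      -- Exchange the sums. A fixed set with at most `s` common out-neighbours in `B` survives for
      -- at most `s ^ ℓ` tuples, and `U` has `∣ U ∣ C Δ` subsets of size `Δ`.
      ∑-exceptions : ∀ ℓ → ∑[ t ∈ tuples (members B) ℓ ] exceptions rich? (sources t) Δ ≤ (∣ U ∣ C Δ) * s ^ ℓ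
      ∑-exceptions ℓ = begin
        ∑[ t ∈ ts ] exceptions rich? (sources t) Δ
          ≡⟨ ∑-cong ts (λ t → length-filter-∑ (exc? t) (allSubsets N)) ⟩
        ∑[ t ∈ ts ] ∑[ S ∈ allSubsets N ] 𝟙 (exc? t S)
          ≡⟨ ∑-comm ts (allSubsets N) (λ t S → 𝟙 (exc? t S)) ⟩
        ∑[ S ∈ allSubsets N ] ∑[ t ∈ ts ] 𝟙 (exc? t S)
          ≤⟨ ∑-mono-≤ (allSubsets N) bound ⟩
        ∑[ S ∈ allSubsets N ] (𝟙 ((S ⊆? U) ×-dec (∣ S ∣ ≟ Δ)) * s ^ ℓ)
          ≡⟨ *-distribʳ-∑ (s ^ ℓ) (allSubsets N) (λ S → 𝟙 ((S ⊆? U) ×-dec (∣ S ∣ ≟ Δ))) ⟨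
        ∑ (allSubsets N) (λ S → 𝟙 ((S ⊆? U) ×-dec (∣ S ∣ ≟ Δ))) * s ^ ℓ
          ≡⟨ cong (_* s ^ ℓ) (∑-subsets U Δ) ⟩
        (∣ U ∣ C Δ) * s ^ ℓ ∎
        where
        open ≤-Reasoning
        ts : List (List (Fin N))
        ts = tuples (members B) ℓ
        exc? : ∀ t → Decidable (λ S → S ⊆ sources t × ∣ S ∣ ≡ Δ × ¬ (∣ N⁺ T S ∩ B ∣ ≥ s + 1))
        exc? t S = (S ⊆? sources t) ×-dec ((∣ S ∣ ≟ Δ) ×-dec ¬? (rich? S))
        vanish : ∀ S → (∀ t → ¬ (S ⊆ sources t × ∣ S ∣ ≡ Δ × ¬ (∣ N⁺ T S ∩ B ∣ ≥ s + 1))) →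
                 ∀ {m} → ∑[ t ∈ ts ] 𝟙 (exc? t S) ≤ m
        vanish S ¬e = ≤-trans (≤-reflexive (trans (∑-cong ts λ t → 𝟙-no (exc? t S) (¬e t)) (∑-zero ts))) z≤n
        bound : ∀ S → ∑[ t ∈ ts ] 𝟙 (exc? t S) ≤ 𝟙 ((S ⊆? U) ×-dec (∣ S ∣ ≟ Δ)) * s ^ ℓ
        bound S = go ((S ⊆? U) ×-dec (∣ S ∣ ≟ Δ)) (rich? S)
          where
          -- With the decisions as arguments, matching on `d` evaluates `𝟙 d` in the bound.
          go : (d : Dec (S ⊆ U × ∣ S ∣ ≡ Δ)) → Dec (∣ N⁺ T S ∩ B ∣ ≥ s + 1) →
               ∑[ t ∈ ts ] 𝟙 (exc? t S) ≤ 𝟙 d * s ^ ℓ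
          go (no ¬p) _          = vanish S λ t (S⊆ , ∣S∣≡Δ , _) → ¬p (⊆-trans S⊆ (sources⊆ t) , ∣S∣≡Δ)
          go (yes _) (yes rich) = vanish S λ t (_ , _ , ¬rich) → ¬rich rich
          go (yes _) (no ¬rich) = begin
            ∑[ t ∈ ts ] 𝟙 (exc? t S)
              ≤⟨ ∑-mono-≤ ts (λ t → 𝟙-mono (exc? t S) (all? (_∈? N⁺ T S) t) (common⊆ ∘ proj₁)) ⟩
            ∑[ t ∈ ts ] 𝟙 (all? (_∈? N⁺ T S) t) ≡⟨ ∑-tuples-all (_∈? N⁺ T S) (members B) ℓ ⟩
            (∑[ y ∈ members B ] 𝟙 (y ∈? N⁺ T S)) ^ ℓ ≡⟨ cong (_^ ℓ) (∑-𝟙-N⁺ S) ⟩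
            ∣ N⁺ T S ∩ B ∣ ^ ℓ
              ≤⟨ ^-monoˡ-≤ ℓ (m<1+n⇒m≤n (subst (∣ N⁺ T S ∩ B ∣ <_) (+-comm s 1) (≰⇒> ¬rich))) ⟩
            s ^ ℓ ≡⟨ +-identityʳ (s ^ ℓ) ⟨
            1 * s ^ ℓ ∎

      -- Here `q / r` bounds the edge density from `U` to `B` from below. Over all `∣ B ∣ ^ ℓ`
      -- tuples, the mean of `∣ sources t ∣` is at least `(q / r) ^ ℓ * ∣ U ∣`, and the mean number
      -- of exceptions is at most `(∣ U ∣ C Δ) * (s / ∣ B ∣) ^ ℓ`. Some tuple attains half of the
      -- first bound while exceeding the second by a factor of at most `4 * (r / q) ^ ℓ`.
      -- Denominators are cleared throughout.
      dependentRandomChoice : ∀ ℓ q r → .{{NonZero ∣ U ∣}} → .{{NonZero ∣ B ∣}} → .{{NonZero q}} →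
        ∣ U ∣ * (q * ∣ B ∣) ≤ r * (∑[ x ∈ members U ] ∑[ y ∈ members B ] edge T x y) →
        ∃[ A ] A ⊆ U × ∣ U ∣ * q ^ ℓ ≤ 2 * r ^ ℓ * ∣ A ∣ ×
          exceptions rich? A Δ * q ^ ℓ * ∣ B ∣ ^ ℓ ≤ 4 * r ^ ℓ * ((∣ U ∣ C Δ) * s ^ ℓ)
      dependentRandomChoice ℓ q r dense =
        let t , large , few = averaging ts (λ t → ∣ sources t ∣) (λ t → exceptions rich? (sources t) Δ)
                                ∣ U ∣ (q ^ ℓ) (r ^ ℓ) ((∣ U ∣ C Δ) * s ^ ℓ)
                                {{it}} {{m^n≢0 q ℓ}} {{subst NonZero (sym ∣ts∣) (m^n≢0 ∣ B ∣ ℓ)}}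
                                (λ t → p⊆q⇒∣p∣≤∣q∣ (sources⊆ t)) mean (∑-exceptions ℓ)
        in sources t , sources⊆ t , large ,
           subst (λ n → exceptions rich? (sources t) Δ * q ^ ℓ * n ≤ _) ∣ts∣ few
        where
        open ≤-Reasoning
        ts : List (List (Fin N))
        ts = tuples (members B) ℓ
        ∣ts∣ : length ts ≡ ∣ B ∣ ^ ℓ
        ∣ts∣ = trans (length-tuples (members B) ℓ) (cong (_^ ℓ) (length-members B))
        mean : ∣ U ∣ * q ^ ℓ * length ts ≤ r ^ ℓ * ∑ ts (λ t → ∣ sources t ∣)
        mean = begin
          ∣ U ∣ * q ^ ℓ * length ts                        ≡⟨ cong (∣ U ∣ * q ^ ℓ *_) ∣ts∣ ⟩
          ∣ U ∣ * q ^ ℓ * ∣ B ∣ ^ ℓ                        ≡⟨ *-assoc ∣ U ∣ (q ^ ℓ) (∣ B ∣ ^ ℓ) ⟩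
          ∣ U ∣ * (q ^ ℓ * ∣ B ∣ ^ ℓ)                      ≡⟨ cong (∣ U ∣ *_) (^-distribʳ-* ℓ q ∣ B ∣) ⟨
          ∣ U ∣ * (q * ∣ B ∣) ^ ℓ                          ≡⟨ cong (_* (q * ∣ B ∣) ^ ℓ) (length-members U) ⟨
          length (members U) * (q * ∣ B ∣) ^ ℓ
            -- Scaling the degrees by `r` makes `q * ∣ B ∣`, a natural number, a lower bound for
            -- their mean.
            ≤⟨ power-mean (members U) (λ x → r * degree x) (q * ∣ B ∣) ℓ
                 (subst₂ _≤_ (cong (_* (q * ∣ B ∣)) (sym (length-members U)))
                             (*-distribˡ-∑ r (members U) degree) dense) ⟩
          ∑[ x ∈ members U ] ((r * degree x) ^ ℓ)          ≡⟨ ∑-cong (members U) (λ x → ^-distribʳ-* ℓ r (degree x)) ⟩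
          ∑[ x ∈ members U ] (r ^ ℓ * degree x ^ ℓ)        ≡⟨ *-distribˡ-∑ (r ^ ℓ) (members U) (λ x → degree x ^ ℓ) ⟨
          r ^ ℓ * ∑ (members U) (λ x → degree x ^ ℓ)       ≡⟨ cong (r ^ ℓ *_) (∑-∣sources∣ ℓ) ⟨
          r ^ ℓ * ∑ ts (λ t → ∣ sources t ∣)               ∎

-- Rational expressions as unreduced fractions.

module Fractions where
  open import Defs
  open import Data.Integer.Base as ℤ using (+_)
  import Data.Integer.Properties as ℤ
  open import Data.Nat.Base as ℕ using (ℕ; zero; suc; NonZero; 2+)
  open import Data.Rational.Base using (ℚ; toℚᵘ; _/_; _*_; _≤_; +-*-rawSemiring)
  open import Data.Rational.Properties using (toℚᵘ-fromℚᵘ; toℚᵘ-homo-*; toℚᵘ-cancel-≤)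
  open import Data.Rational.Unnormalised.Base as ℚᵘ using (mkℚᵘ; _≃_; *≤*)
  import Data.Rational.Unnormalised.Properties as ℚᵘ
  open import Algebra.Definitions.RawSemiring +-*-rawSemiring using (_^_)
  open import Relation.Binary.PropositionalEquality

  -- Rationals are kept in lowest terms, which hides numerators and denominators. Equality with an
  -- unnormalised fraction lets both be tracked through products and powers.
  record _Equals_Over_ (x : ℚ) (n d : ℕ) : Set where
    constructor fraction
    field
      .{{nonZero}} : NonZero d
      equality     : toℚᵘ x ≃ (+ n ℚᵘ./ d)

  /-fraction : ∀ n d .{{_ : NonZero d}} → (+ n / d) Equals n Over d
  /-fraction n (suc d) = fraction (toℚᵘ-fromℚᵘ (mkℚᵘ (+ n) d))

  *-fraction : ∀ {x y n d n′ d′} → x Equals n Over d → y Equals n′ Over d′ →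
               (x * y) Equals (n ℕ.* n′) Over (d ℕ.* d′)
  *-fraction {x} {y} {n} {suc d} {n′} {suc d′} (fraction p) (fraction q) = fraction
    (ℚᵘ.≃-trans (toℚᵘ-homo-* x y) (ℚᵘ.≃-trans (ℚᵘ.*-cong p q)
      (ℚᵘ.≃-reflexive (cong (λ m → mkℚᵘ m _) (sym (ℤ.pos-* n n′))))))

  ^-fraction : ∀ {x n d} → x Equals n Over d → ∀ ℓ → (x ^ ℓ) Equals (n ℕ.^ ℓ) Over (d ℕ.^ ℓ)
  ^-fraction p zero    = /-fraction 1 1
  ^-fraction p (suc ℓ) = *-fraction p (^-fraction p ℓ)

  -- Cross-multiplication; it turns both rational bounds of the theorem into inequalities of natural
  -- numbers.
  ≤-fraction : ∀ {x y n d n′ d′} → x Equals n Over d → y Equals n′ Over d′ →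
               n ℕ.* d′ ℕ.≤ n′ ℕ.* d → x ≤ y
  ≤-fraction {n = n} {suc d} {n′} {suc d′} (fraction p) (fraction q) h = toℚᵘ-cancel-≤
    (ℚᵘ.≤-respˡ-≃ (ℚᵘ.≃-sym p) (ℚᵘ.≤-respʳ-≃ (ℚᵘ.≃-sym q)
      (*≤* (subst₂ ℤ._≤_ (ℤ.pos-* n (suc d′)) (ℤ.pos-* n′ (suc d)) (ℤ.+≤+ h)))))

  [k-1]/[2k]-fraction : ∀ k → [k-1]/[2k] (2+ k) Equals suc k Over (2 ℕ.* 2+ k)
  [k-1]/[2k]-fraction k = /-fraction (suc k) (2 ℕ.* 2+ k)

  [2k]/[k-1]-fraction : ∀ k → [2k]/[k-1] (2+ k) Equals (2 ℕ.* 2+ k) Over suc k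
  [2k]/[k-1]-fraction k = /-fraction (2 ℕ.* 2+ k) (suc k)

-- The result in natural numbers.

module RichSubset where
  open import Defs
  open import Data.Fin.Base using (Fin)
  open import Data.Fin.Subset using (Subset; _∈_; _⊆_; _∩_; ∣_∣)
  open import Data.Fin.Subset.Properties using (_∈?_)
  open import Data.List.Base using (allFin; length)
  import Data.List.Relation.Unary.All as All
  open import Data.List.Relation.Unary.All.Properties using (all-filter)
  open import Data.Nat.Base using (ℕ; suc; _+_; _*_; _∸_; _^_; _≤_; _<_; NonZero; 2+)
  open import Data.Nat.Combinatorics using (_C_)
  open import Data.Nat.Properties
  open import Data.Nat.Tactic.RingSolver using (solve-∀)
  open import Data.Product.Base using (_×_; _,_; ∃-syntax)
  open import Relation.Binary.PropositionalEquality
  open import Relation.Nullary.Decidable using (_×-dec_)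
  open FiniteSums
  open MedianOrders
  open Blocks
  open DependentRandomChoice

  module _ {N} (v : Ordering N) (i m : ℕ) where
    private
      inside? : (x : Fin N) → _
      inside? x = (i ≤? position v x) ×-dec (position v x <? m)

    ∈-interval⁻ : ∀ {x} → x ∈ [ i , m ⟩ v → i ≤ position v x × position v x < m
    ∈-interval⁻ = ∈-comprehension⁻ inside?

    𝟙-interval : ∀ x → 𝟙 (x ∈? [ i , m ⟩ v) ≡ within v i m x
    𝟙-interval x = 𝟙-cong (x ∈? [ i , m ⟩ v) (inside? x) (∈-comprehension⁻ inside?) (∈-comprehension⁺ inside?)

    ∑-members-interval : ∀ f → ∑ (members ([ i , m ⟩ v)) f ≡ weight v f i m
    ∑-members-interval f =
      trans (∑-filter (_∈? [ i , m ⟩ v) (allFin N) f) (∑-cong (allFin N) λ x → cong (_* f x) (𝟙-interval x))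

  ∣interval∣ : ∀ {N} (v : Ordering N) i c → 1 ≤ i → i + c ≤ suc N → ∣ [ i , i + c ⟩ v ∣ ≡ c
  ∣interval∣ {N} v i c 1≤i i+c≤1+N = +-cancelˡ-≡ i _ _ (trans
    (cong (i +_) (trans (∣∣-∑ ([ i , i + c ⟩ v)) (∑-cong (allFin N) (𝟙-interval v i (i + c)))))
    (∑-within v 1≤i (m≤m+n i c) i+c≤1+N))

  -- The theorem with denominators cleared and `∣ B ∣` in place of `b`. Its `k` is `2+ k` here, so
  -- that `suc k` is its `k - 1`, and `c` is its `a′`.
  richSubset : ∀ {N} a c ℓ s k Δ .{{_ : NonZero c}} → a ≤ 2 * c →
    (T : Tournament N) (v : Ordering N) → IsMedianOrder T v →
    ∀ j → 2 * 2+ k * c < j → j + a ≤ N + 1 →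
    (B : Subset N) → B ⊆ [ j , j + a ⟩ v → .{{NonZero ∣ B ∣}} →
    ∃[ j′ ] ∃[ A ] j ∸ 2 * 2+ k * c ≤ j′ × j′ ≤ j ∸ c × A ⊆ [ j′ , j′ + c ⟩ v ×
      c * suc k ^ ℓ ≤ 2 * (2 * 2+ k) ^ ℓ * ∣ A ∣ ×
      exceptions (λ S → ∣ N⁺ T S ∩ B ∣ ≥? s + 1) A Δ * suc k ^ ℓ * ∣ B ∣ ^ ℓ
        ≤ 4 * (2 * 2+ k) ^ ℓ * ((c C Δ) * s ^ ℓ)
  richSubset {N} a c ℓ s k Δ {{c≢0}} a≤2c T v median j 2kc<j j+a≤N+1 B B⊆ =
    conclude (dense-block v T median i c (suc k) a 1≤i a≤2c (members B)
      (All.map located (all-filter (_∈? B) (allFin N))))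
    where
    i : ℕ
    -- As `2 * 2+ k * c < j`, the subtraction is exact and `i` is a valid 1-based index.
    i = j ∸ 2 * 2+ k * c
    1≤i : 1 ≤ i
    1≤i = m<n⇒0<n∸m 2kc<j
    i+2kc : i + 2 * 2+ k * c ≡ j
    i+2kc = m∸n+n≡m (<⇒≤ 2kc<j)
    j≤1+N : j ≤ suc N
    j≤1+N = ≤-trans (m≤m+n j a) (subst (j + a ≤_) (+-comm N 1) j+a≤N+1)
    located : ∀ {y} → y ∈ B → i + 2 * 2+ k * c ≤ position v y × position v y < i + 2 * 2+ k * c + a
    located {y} y∈B =
      subst (λ j → j ≤ position v y × position v y < j + a) (sym i+2kc) (∈-interval⁻ v j (j + a) (B⊆ y∈B))
    degree : Fin N → ℕ
    degree x = ∑[ y ∈ members B ] edge T x y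
    swap : ∀ b k c → b * (k * c) ≡ c * (k * b)
    swap = solve-∀

    -- The block size is a parameter, so that the bounds obtained for the cardinality of the block
    -- can be transported to `c`.
    Rich : Subset N → ℕ → Set
    Rich A u = u * suc k ^ ℓ ≤ 2 * (2 * 2+ k) ^ ℓ * ∣ A ∣ ×
      exceptions (λ S → ∣ N⁺ T S ∩ B ∣ ≥? s + 1) A Δ * suc k ^ ℓ * ∣ B ∣ ^ ℓ
        ≤ 4 * (2 * 2+ k) ^ ℓ * ((u C Δ) * s ^ ℓ)

    choose : ∀ i′ → ∣ [ i′ , i′ + c ⟩ v ∣ ≡ c →
      length (members B) * (suc k * c) ≤ 2 * 2+ k * weight v degree i′ (i′ + c) →
      ∃[ A ] A ⊆ [ i′ , i′ + c ⟩ v × Rich A ∣ [ i′ , i′ + c ⟩ v ∣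
    choose i′ ∣U∣≡c dense = dependentRandomChoice T U B s Δ ℓ (suc k) (2 * 2+ k)
      {{subst NonZero (sym ∣U∣≡c) c≢0}} (begin
      ∣ U ∣ * (suc k * ∣ B ∣)                     ≡⟨ cong (_* (suc k * ∣ B ∣)) ∣U∣≡c ⟩
      c * (suc k * ∣ B ∣)                         ≡⟨ swap ∣ B ∣ (suc k) c ⟨
      ∣ B ∣ * (suc k * c)                         ≡⟨ cong (_* (suc k * c)) (length-members B) ⟨
      length (members B) * (suc k * c)            ≤⟨ dense ⟩
      2 * 2+ k * weight v degree i′ (i′ + c)      ≡⟨ cong (2 * 2+ k *_) (∑-members-interval v i′ (i′ + c) degree) ⟨
      2 * 2+ k * ∑ (members U) degree             ∎)
      where
      open ≤-Reasoning
      U : Subset N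
      U = [ i′ , i′ + c ⟩ v

    conclude : (∃[ i′ ] i ≤ i′ × i′ + c ≤ i + 2 * 2+ k * c ×
        length (members B) * (suc k * c) ≤ 2 * 2+ k * weight v degree i′ (i′ + c)) →
      ∃[ j′ ] ∃[ A ] i ≤ j′ × j′ ≤ j ∸ c × A ⊆ [ j′ , j′ + c ⟩ v × Rich A c
    conclude (i′ , i≤i′ , i′+c≤ , dense) =
      let A , A⊆U , rich = choose i′ ∣U∣≡c dense in
      i′ , A , i≤i′ , m+n≤o⇒m≤o∸n i′ i′+c≤j , A⊆U , subst (Rich A) ∣U∣≡c rich
      where
      i′+c≤j : i′ + c ≤ j
      i′+c≤j = subst (i′ + c ≤_) i+2kc i′+c≤
      ∣U∣≡c : ∣ [ i′ , i′ + c ⟩ v ∣ ≡ c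
      ∣U∣≡c = ∣interval∣ v i′ c (≤-trans 1≤i i≤i′) (≤-trans i′+c≤j j≤1+N)

-- From natural numbers to the rational bounds.

open import Defs
open import Data.Fin.Subset using (Subset; _⊆_; _∩_; ∣_∣)
open import Data.Integer.Base using (+_)
open import Data.Nat.Base as ℕ using (ℕ; _∸_; NonZero; NonTrivial)
open import Data.Nat.Combinatorics using (_C_)
open import Data.Product.Base using (∃-syntax; _×_; _,_)
open import Data.Rational.Base using (_/_; _*_; _≤_; _≥_; +-*-rawSemiring)
open import Algebra.Definitions.RawSemiring +-*-rawSemiring using (_^_)
open import Data.Nat.Properties using (_≥?_)
import Data.Nat.Properties as ℕ
open import Data.Nat.Tactic.RingSolver using (solve-∀)
open import Relation.Binary.PropositionalEquality using (_≡_)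
open Fractions
open RichSubset using (richSubset)

lemma2p2 : ∀ (a a′ b ℓ s N k Δ : ℕ)
    .{{_ : NonZero a}} .{{_ : NonZero a′}} .{{_ : NonZero b}} .{{_ : NonZero ℓ}}
    .{{_ : NonZero s}} .{{_ : NonZero N}} .{{_ : NonTrivial k}} .{{_ : NonZero Δ}} →
    2 ℕ.* a′ ℕ.≥ a →
    (T : Tournament N) (v : Ordering N) → IsMedianOrder T v →
    (j : ℕ) → 2 ℕ.* k ℕ.* a′ ℕ.< j → j ℕ.+ a ℕ.≤ N ℕ.+ 1 →
    (B : Subset N) → B ⊆ [ j , j ℕ.+ a ⟩ v → ∣ B ∣ ℕ.≥ b →
    ∃[ j′ ] ∃[ A ]
    (j ∸ 2 ℕ.* k ℕ.* a′ ℕ.≤ j′) × (j′ ℕ.≤ j ∸ a′) ×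
    (A ⊆ [ j′ , j′ ℕ.+ a′ ⟩ v) ×
    (+ ∣ A ∣ / 1 ≥ (+ a′ / 2) * ([k-1]/[2k] k ^ ℓ)) ×
    (+ exceptions (λ S → ∣ N⁺ T S ∩ B ∣ ≥? s ℕ.+ 1) A Δ / 1
    ≤ (+ 4 / 1) * ([2k]/[k-1] k ^ ℓ) * (+ (a′ C Δ) / 1) * ((+ s / b) ^ ℓ))
-- Matching `k` as `2+ k` turns `k - 1` into a successor, which makes it visibly a nonzero
-- denominator.
lemma2p2 a a′ b ℓ s N (ℕ.2+ k) Δ a≤2a′ T v median j 2ka′<j j+a≤N+1 B B⊆ b≤∣B∣ =
  let j′ , A , j≤j′ , j′≤ , A⊆ , many , exceptional =
        richSubset a a′ ℓ s k Δ a≤2a′ T v median j 2ka′<j j+a≤N+1 B B⊆ {{∣B∣≢0}}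
  in j′ , A , j≤j′ , j′≤ , A⊆ , large A many , few A exceptional
  where
  ∣B∣≢0 : NonZero ∣ B ∣
  ∣B∣≢0 = ℕ.>-nonZero (ℕ.<-≤-trans (ℕ.>-nonZero⁻¹ b) b≤∣B∣)
  Q R : ℕ
  Q = ℕ.suc k ℕ.^ ℓ
  R = (2 ℕ.* ℕ.2+ k) ℕ.^ ℓ
  exc : Subset N → ℕ
  exc A = exceptions (λ S → ∣ N⁺ T S ∩ B ∣ ≥? s ℕ.+ 1) A Δ

  large : ∀ A → a′ ℕ.* Q ℕ.≤ 2 ℕ.* R ℕ.* ∣ A ∣ → (+ a′ / 2) * ([k-1]/[2k] (ℕ.2+ k) ^ ℓ) ≤ + ∣ A ∣ / 1
  large A h = ≤-fraction
    (*-fraction (/-fraction a′ 2) (^-fraction ([k-1]/[2k]-fraction k) ℓ)) (/-fraction ∣ A ∣ 1)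
    (begin
      a′ ℕ.* Q ℕ.* 1        ≡⟨ ℕ.*-identityʳ (a′ ℕ.* Q) ⟩
      a′ ℕ.* Q              ≤⟨ h ⟩
      2 ℕ.* R ℕ.* ∣ A ∣     ≡⟨ ℕ.*-comm (2 ℕ.* R) ∣ A ∣ ⟩
      ∣ A ∣ ℕ.* (2 ℕ.* R)   ∎)
    where open ℕ.≤-Reasoning

  few : ∀ A → exc A ℕ.* Q ℕ.* ∣ B ∣ ℕ.^ ℓ ℕ.≤ 4 ℕ.* R ℕ.* ((a′ C Δ) ℕ.* s ℕ.^ ℓ) →
        + exc A / 1 ≤ (+ 4 / 1) * ([2k]/[k-1] (ℕ.2+ k) ^ ℓ) * (+ (a′ C Δ) / 1) * ((+ s / b) ^ ℓ)
  few A h = ≤-fraction (/-fraction (exc A) 1)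
    (*-fraction (*-fraction (*-fraction (/-fraction 4 1) (^-fraction ([2k]/[k-1]-fraction k) ℓ))
                            (/-fraction (a′ C Δ) 1))
                (^-fraction (/-fraction s b) ℓ))
    (begin
      -- The factors `1` are the denominators of `+ 4 / 1` and `+ (a′ C Δ) / 1`.
      exc A ℕ.* (1 ℕ.* Q ℕ.* 1 ℕ.* b ℕ.^ ℓ)          ≡⟨ regroup₁ (exc A) Q (b ℕ.^ ℓ) ⟩
      -- The bound was obtained with `∣ B ∣` as denominator; since `b ≤ ∣ B ∣`, replacing it by `b`
      -- only weakens the bound.
      exc A ℕ.* Q ℕ.* b ℕ.^ ℓ                        ≤⟨ ℕ.*-monoʳ-≤ (exc A ℕ.* Q) (ℕ.^-monoˡ-≤ ℓ b≤∣B∣) ⟩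
      exc A ℕ.* Q ℕ.* ∣ B ∣ ℕ.^ ℓ                    ≤⟨ h ⟩
      4 ℕ.* R ℕ.* ((a′ C Δ) ℕ.* s ℕ.^ ℓ)             ≡⟨ regroup₂ R (a′ C Δ) (s ℕ.^ ℓ) ⟩
      4 ℕ.* R ℕ.* (a′ C Δ) ℕ.* s ℕ.^ ℓ ℕ.* 1         ∎)
    where
    open ℕ.≤-Reasoning
    regroup₁ : ∀ e q b → e ℕ.* (1 ℕ.* q ℕ.* 1 ℕ.* b) ≡ e ℕ.* q ℕ.* b
    regroup₁ = solve-∀
    regroup₂ : ∀ r c s → 4 ℕ.* r ℕ.* (c ℕ.* s) ≡ 4 ℕ.* r ℕ.* c ℕ.* s ℕ.* 1
    regroup₂ = solve-∀
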